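{- Let $\mu:G\times H\to K$ be a graph homomorphism, where $K$ is square-free and $G$ and $H$ are connected and non-bipartite. Then there are graph homomorphisms $\mu^*:G\times H\to K$, $\gamma:G\times H\to I$ and $\delta:I\to K$ such that $\mu^*=\delta\circ\gamma$ and $\mu^*$ is reachable from $\mu$ by recoloring, where $I$ is either $G$, $H$, or $C_n$ for some $n\in\mathbb{N}$.
   Context: All graphs are finite, simple, loopless; every graph has at least two vertices and no isolated vertices. $G\times H$ is the tensor product (vertices $V(G)\times V(H)$, $(g,h)(g',h')$ an edge iff $gg'\in E(G)$ and $hh'\in E(H)$). A graph is square-free if there are no four pairwise distinct vertices $v_1,\dots,v_4$ with $v_1v_2,v_2v_3,v_3v_4,v_4v_1$ edges. $C_n$ is the graph with vertex set $\{0,\dots,n-1\}$ and edges $\{i,i+1\bmod n\}$. A $K$-coloring of a graph is a homomorphism to $K$; $\mu^*$ is reachable from $\mu$ by recoloring if there is a sequence of $K$-colorings $\mu=\mu_0,\dots,\mu_m=\mu^*$ of $G\times H$ with consecutive ones differing on at most one vertex. -}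

module Defs where

open import Data.Nat using (ℕ; zero; suc; _≤_)
open import Data.Nat.DivMod using (_%_)
open import Data.Fin using (Fin; toℕ)
open import Data.Bool using (Bool)
open import Data.Product using (Σ; ∃; _×_; _,_)
open import Data.Sum using (_⊎_)
open import Data.Empty using (⊥)
open import Relation.Nullary using (¬_; Dec)
open import Relation.Binary.PropositionalEquality using (_≡_; _≢_)
open import Function.Bundles using (_↔_)

record RawGraph : Set₁ where
  field
    V   : Set
    Adj : V → V → Set
open RawGraph public

record Graph : Set₁ where
  field
    raw        : RawGraph
    size       : ℕ
    enum       : V raw ↔ Fin size
    adj?       : ∀ u v → Dec (Adj raw u v)
    symm       : ∀ {u v} → Adj raw u v → Adj raw v u
    loopless   : ∀ v → ¬ Adj raw v v
    twoVerts   : 2 ≤ size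
    noIsolated : ∀ v → ∃ λ w → Adj raw v w
open Graph public

Vx : Graph → Set
Vx G = V (raw G)

E : (G : Graph) → Vx G → Vx G → Set
E G = Adj (raw G)

data Walk (G : Graph) : Vx G → Vx G → Set where
  here : ∀ {v} → Walk G v v
  step : ∀ {u v w} → E G u v → Walk G v w → Walk G u w

Connected : Graph → Set
Connected G = ∀ u v → Walk G u v

Bipartite : Graph → Set
Bipartite G = Σ (Vx G → Bool) λ c → ∀ u v → E G u v → c u ≢ c v

SquareFree : Graph → Set
SquareFree G = ∀ v₁ v₂ v₃ v₄ →
  v₁ ≢ v₂ → v₁ ≢ v₃ → v₁ ≢ v₄ → v₂ ≢ v₃ → v₂ ≢ v₄ → v₃ ≢ v₄ →
  ¬ (E G v₁ v₂ × E G v₂ v₃ × E G v₃ v₄ × E G v₄ v₁)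

_⊗_ : RawGraph → RawGraph → RawGraph
G ⊗ H = record
  { V   = V G × V H
  ; Adj = λ { (g , h) (g' , h') → Adj G g g' × Adj H h h' } }

CAdj : (n : ℕ) → Fin n → Fin n → Set
CAdj zero    i j = ⊥
CAdj (suc k) i j = i ≢ j × (toℕ j ≡ suc (toℕ i) % suc k ⊎ toℕ i ≡ suc (toℕ j) % suc k)

Cyc : ℕ → RawGraph
Cyc n = record { V = Fin n ; Adj = CAdj n }

record Hom (A B : RawGraph) : Set where
  constructor hom
  field
    fun  : V A → V B
    pres : ∀ {x y} → Adj A x y → Adj B (fun x) (fun y)
open Hom public

AtMostOneDiff : ∀ {A B : RawGraph} → Hom A B → Hom A B → Set
AtMostOneDiff {A} μ ν = Σ (V A) λ v → ∀ w → w ≢ v → fun μ w ≡ fun ν w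

data Reachable {A B : RawGraph} (μ : Hom A B) : Hom A B → Set where
  start : Reachable μ μ
  next  : ∀ {ν ν'} → Reachable μ ν → AtMostOneDiff ν ν' → Reachable μ ν'

FactorsThrough : ∀ {A B : RawGraph} → Hom A B → RawGraph → Set
FactorsThrough {A} {B} μ I =
  Σ (Hom A I) λ γ → Σ (Hom I B) λ δ → ∀ x → fun μ x ≡ fun δ (fun γ x)

{-# OPTIONS --safe #-}

-- The points of the universal cover of K are handled through ends: non-backtracking infinite
-- walks, on which a walk of G × H acts by prepending the colours it meets.  As K is square-free,
-- 4-cycles of G × H act trivially, so even closed walks of G (with H going back and forth along
-- an edge) commute with those of H.  An odd closed walk σ of G × H fixes an end s and translates
-- along it; as σ² is the product of an even closed walk of G and one of H, one of these, say the
-- one of G, translates along s as well.  A nontrivial translation fixes at most one end in its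
-- direction, so every even closed walk of H fixes s.
--
-- * If s can be transported consistently to all vertices, the ends become purely periodic after
--   recolouring, and μ then follows a single cycle.
-- * Otherwise no even closed walk of H translates along s, so the heights along s are well
--   defined in each column {g} × H.  Unless μ is constant on all columns, going from column to
--   column in the direction in which the maximal height grows soon reaches a non-constant column
--   with topmost vertices that can be recoloured like vertices nearby in the column.

module Submission where

open import Defs
open import Data.Bool using (Bool; true; false; not; _xor_)
import Data.Bool.Properties as Boolₚ
open import Data.Fin using (Fin; fromℕ<; toℕ)
import Data.Fin.Properties as Finₚ
open import Data.Integer as ℤ using (ℤ; 0ℤ; 1ℤ; -1ℤ; +_; -_; -[1+_])
import Data.Integer.Properties as ℤₚ
open import Data.Integer.Tactic.RingSolver using (solve-∀)
open import Data.List using (List; []; _∷_; map; allFin; cartesianProduct)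
open import Data.List.Membership.Propositional using (_∈_; find; lose)
open import Data.List.Membership.Propositional.Properties
  using (∈-map⁺; ∈-allFin; ∈-cartesianProduct⁺)
open import Data.List.Relation.Unary.Any as Any using (here; there)
open import Data.Nat as ℕ using (ℕ; zero; suc; _≤_; z≤n; s≤s)
open import Data.Nat.DivMod
  using (_%_; _/_; m<n⇒m%n≡m; n%n≡0; m%n<n; [m+n]%n≡m%n; %-distribˡ-+; m%n%n≡m%n; m≡m%n+[m/n]*n)
open import Data.Nat.Induction using (Acc; acc; <-wellFounded)
import Data.Nat.Properties as ℕₚ
open import Data.Product using (Σ; ∃; ∃₂; _×_; _,_; proj₁; proj₂)
import Data.Product.Properties as Productₚ
open import Data.Sum using (_⊎_; inj₁; inj₂)
open import Function.Base using (_∘_)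
open import Function.Bundles using (Inverse)
open import Function.Properties.Inverse using (↔⇒↣)
open import Relation.Binary.Definitions using (DecidableEquality; tri<; tri≈; tri>)
open import Relation.Binary.PropositionalEquality
open import Relation.Nullary using (¬_; Dec; yes; no; contradiction)
open import Relation.Nullary.Decidable using (map′; via-injection; _×-dec_; ¬?)

-- Finite graphs and walks

record Listed (A : Set) : Set where
  field
    elems    : List A
    complete : ∀ a → a ∈ elems
open Listed

listedVertices : (G : Graph) → Listed (Vx G)
listedVertices G = record
  { elems    = map (Inverse.from (enum G)) (allFin (size G))
  ; complete = λ v → subst (_∈ _) (Inverse.strictlyInverseʳ (enum G) v)
                       (∈-map⁺ _ (∈-allFin (Inverse.to (enum G) v))) }

_×-listed_ : ∀ {A B : Set} → Listed A → Listed B → Listed (A × B)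
LA ×-listed LB = record
  { elems    = cartesianProduct (elems LA) (elems LB)
  ; complete = λ (a , b) → ∈-cartesianProduct⁺ (complete LA a) (complete LB b) }

any-listed? : ∀ {A : Set} → Listed A → {P : A → Set} → (∀ a → Dec (P a)) → Dec (∃ P)
any-listed? L P? = map′ (λ p → let (a , _ , pa) = find p in a , pa)
                        (λ (a , pa) → lose (complete L a) pa)
                        (Any.any? P? (elems L))

bounded-listed : ∀ {A : Set} → Listed A → (f : A → ℕ) → ∃ λ m → ∀ a → f a ≤ m
bounded-listed {A} L f = let (m , b) = go (elems L) in m , λ a → b (complete L a)
  where
  go : (xs : List A) → ∃ λ m → ∀ {a} → a ∈ xs → f a ≤ m
  go []       = 0 , λ ()
  go (x ∷ xs) = let (m , b) = go xs in
    f x ℕ.⊔ m , λ { (here refl) → ℕₚ.m≤m⊔n (f x) m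
                  ; (there a∈)  → ℕₚ.≤-trans (b a∈) (ℕₚ.m≤n⊔m (f x) m) }

vertex-≟ : (G : Graph) → DecidableEquality (Vx G)
vertex-≟ G = via-injection (↔⇒↣ (enum G)) Finₚ._≟_

someVertex : (G : Graph) → Vx G
someVertex G = Inverse.from (enum G) (fromℕ< (twoVerts G))

-- Walks indexed by the parity of their length (true for odd).
data Wk (R : RawGraph) : Bool → V R → V R → Set where
  nil  : ∀ {x} → Wk R false x x
  step : ∀ {b x y z} → Adj R x y → Wk R (not b) y z → Wk R b x z

infixr 5 _++_
_++_ : ∀ {R b c x y z} → Wk R b x y → Wk R c y z → Wk R (b xor c) x z
nil                      ++ v = v
_++_ {b = false} (step e w)             v = step e (w ++ v)
_++_ {b = true} {c = false} (step e w)  v = step e (w ++ v)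
_++_ {b = true} {c = true}  (step e w)  v = step e (w ++ v)

fromWalk : ∀ {G u v} → Walk G u v → ∃ λ b → Wk (raw G) b u v
fromWalk here       = false , nil
fromWalk (step e w) with fromWalk w
... | false , w′ = true  , step e w′
... | true  , w′ = false , step e w′

-- If the parities of the chosen walks from `r` agree at both ends of an edge `u v`, then two closed
-- walks at `r` have opposite parities: one goes to `v` directly, the other through `u` and the
-- edge, and both return along `back`. The odd one is spliced into a walk through `r` to correct its
-- parity.
parityWalk : (G : Graph) → Connected G → ¬ Bipartite G → ∀ b u v → Wk (raw G) b u v
parityWalk G conn ¬bip = walk
  where
  R = raw G
  r = someVertex G

  colour : Vx G → Bool
  colour v = proj₁ (fromWalk (conn r v))

  monochromaticEdge : ∃ λ u → ∃ λ v → E G u v × colour u ≡ colour v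
  monochromaticEdge
    with any-listed? (listedVertices G) (λ u → any-listed? (listedVertices G) (λ v →
           adj? G u v ×-dec (colour u Boolₚ.≟ colour v)))
  ... | yes p = p
  ... | no ¬p = contradiction (colour , λ u v e eq → ¬p (u , v , e , eq)) ¬bip

  oddAmong : ∀ {b c} → Wk R b r r → Wk R c r r → c ≡ not b → Wk R true r r
  oddAmong {true}  w v _    = w
  oddAmong {false} w v refl = v

  oddClosed : Wk R true r r
  oddClosed with monochromaticEdge
  ... | u , v , e , eq with fromWalk (conn r u) | fromWalk (conn r v) | eq | fromWalk (conn v r)
  ... | b , wᵤ | .b , wᵥ | refl | c , back =
    oddAmong (wᵥ ++ back) (wᵤ ++ edge ++ back) (parity b c)
    where
    edge : Wk R true u v
    edge = step e nil
    parity : ∀ b c → b xor (true xor c) ≡ not (b xor c)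
    parity false c = refl
    parity true  c = refl

  walk : ∀ b u v → Wk R b u v
  walk b u v with fromWalk (conn u r) | fromWalk (conn r v)
  ... | c , w | d , w′ with (c xor d) Boolₚ.≟ b
  ... | yes refl = w ++ w′
  ... | no  ≢b   = subst (λ p → Wk R p u v) (parity c d b ≢b) (w ++ oddClosed ++ w′)
    where
    parity : ∀ c d b → c xor d ≢ b → c xor (true xor d) ≡ b
    parity false false false p = contradiction refl p
    parity false false true  p = refl
    parity false true  false p = refl
    parity false true  true  p = contradiction refl p
    parity true  false false p = refl
    parity true  false true  p = contradiction refl p
    parity true  true  false p = contradiction refl p
    parity true  true  true  p = refl

reachable-trans : ∀ {A B} {μ ν ρ : Hom A B} → Reachable μ ν → Reachable ν ρ → Reachable μ ρ
reachable-trans p start      = p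
reachable-trans p (next q d) = next (reachable-trans p q) d

-- If every edge has an end where μ and ν agree, then every mixture of μ and ν is a
-- homomorphism, so the vertices may be switched one at a time in any order.
module Interpolate {A B : RawGraph} (_≟_ : DecidableEquality (V A)) (L : Listed (V A))
  (B-symm : ∀ {x y} → Adj B x y → Adj B y x)
  (μ ν : Hom A B) (agree : ∀ {x y} → Adj A x y → fun μ x ≡ fun ν x ⊎ fun μ y ≡ fun ν y) where

  open import Data.List.Membership.DecPropositional _≟_ using (_∈?_)

  pick : ∀ {P : Set} → Dec P → V A → V B
  pick (yes _) x = fun ν x
  pick (no  _) x = fun μ x

  pick-either : ∀ {P : Set} (d : Dec P) x → pick d x ≡ fun μ x ⊎ pick d x ≡ fun ν x
  pick-either (yes _) x = inj₂ refl
  pick-either (no  _) x = inj₁ refl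

  pick-agree : ∀ {P : Set} (d : Dec P) {x} → fun μ x ≡ fun ν x → pick d x ≡ fun μ x × pick d x ≡ fun ν x
  pick-agree (yes _) eq = sym eq , refl
  pick-agree (no  _) eq = refl , eq

  pick-adj : ∀ {P Q : Set} (d : Dec P) (d′ : Dec Q) {x y} → Adj A x y → Adj B (pick d x) (pick d′ y)
  pick-adj d d′ {x} {y} e with agree e
  ... | inj₁ eq with pick-agree d eq | pick-either d′ y
  ... | p , _ | inj₁ q = subst₂ (Adj B) (sym p) (sym q) (pres μ e)
  ... | _ , p | inj₂ q = subst₂ (Adj B) (sym p) (sym q) (pres ν e)
  pick-adj d d′ {x} {y} e | inj₂ eq with pick-agree d′ eq | pick-either d x
  ... | p , _ | inj₁ q = subst₂ (Adj B) (sym q) (sym p) (pres μ e)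
  ... | _ , p | inj₂ q = subst₂ (Adj B) (sym q) (sym p) (pres ν e)

  mixture : List (V A) → Hom A B
  mixture xs = hom (λ x → pick (x ∈? xs) x) (pick-adj (_ ∈? xs) (_ ∈? xs))

  pick-∈ : ∀ {x xs} → x ∈ xs → (d : Dec (x ∈ xs)) → pick d x ≡ fun ν x
  pick-∈ x∈ (yes _) = refl
  pick-∈ x∈ (no ∉)  = contradiction x∈ ∉

  pick-cong : ∀ {x} {P Q : Set} → (P → Q) → (Q → P) → (d : Dec P) (d′ : Dec Q) → pick d x ≡ pick d′ x
  pick-cong f g (yes _) (yes _) = refl
  pick-cong f g (yes p) (no ¬q) = contradiction (f p) ¬q
  pick-cong f g (no ¬p) (yes q) = contradiction (g q) ¬p
  pick-cong f g (no _)  (no _)  = refl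

  reach-mixture : V A → ∀ xs → Reachable μ (mixture xs)
  reach-mixture a []       = next start (a , λ _ _ → refl)
  reach-mixture a (x ∷ xs) = next (reach-mixture a xs) (x , λ w w≢x →
    pick-cong there (λ { (here eq) → contradiction eq w≢x ; (there p) → p }) (w ∈? xs) (w ∈? (x ∷ xs)))

  reach : V A → Reachable μ ν
  -- The full mixture agrees with `ν` only pointwise; a last step that changes no colour replaces it
  -- by `ν` itself.
  reach a = next (reach-mixture a (elems L)) (a , λ w _ → pick-∈ (complete L w) (w ∈? elems L))

-- Ends of the universal cover

double-zero : ∀ c → c ℤ.+ c ≡ 0ℤ → c ≡ 0ℤ
double-zero (+ zero)  _ = refl
double-zero (+ suc n) ()
double-zero -[1+ n ]  ()

module Ends (K : Graph) where

  _≟_ = vertex-≟ K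

  -- A reduced ray of K is a boundary point of the universal cover, seen from a lift of `a`. The
  -- height `ht` is a Busemann function towards that point, normalised arbitrarily; it tells apart
  -- lifts from which the ray looks the same.
  record End (a : Vx K) : Set where
    field
      seq   : ℕ → Vx K
      ht    : ℤ
      origin : seq 0 ≡ a
      adj   : ∀ i → E K (seq i) (seq (suc i))
      red   : ∀ i → seq i ≢ seq (suc (suc i))
  open End public

  infix 4 _≈[_]_
  -- When `t` is the image of `s` under a closed walk, `t ≈[ c ] s` reads: the walk fixes the end
  -- and translates by `c` along it.
  record _≈[_]_ {a b} (s : End a) (c : ℤ) (t : End b) : Set where
    constructor _,≈_
    field
      pts : ∀ i → seq s i ≡ seq t i
      hts : ht s ≡ c ℤ.+ ht t
  open _≈[_]_ public

  ≈-refl : ∀ {a} {s : End a} → s ≈[ 0ℤ ] s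
  ≈-refl = (λ _ → refl) ,≈ sym (ℤₚ.+-identityˡ _)

  ≈-sym : ∀ {c a b} {s : End a} {t : End b} → s ≈[ c ] t → t ≈[ - c ] s
  ≈-sym {c} {s = s} {t} (p ,≈ q) = (λ i → sym (p i)) ,≈ trans (lem c (ht t)) (cong (λ z → (- c) ℤ.+ z) (sym q))
    where
    lem : ∀ c z → z ≡ - c ℤ.+ (c ℤ.+ z)
    lem = solve-∀

  ≈-trans : ∀ {c d a b e} {s : End a} {t : End b} {u : End e} →
            s ≈[ c ] t → t ≈[ d ] u → s ≈[ c ℤ.+ d ] u
  ≈-trans {c} {d} {u = u} (p ,≈ q) (p′ ,≈ q′) =
    (λ i → trans (p i) (p′ i)) ,≈ trans q (trans (cong (λ z → c ℤ.+ z) q′) (sym (ℤₚ.+-assoc c d (ht u))))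

  ≈-sym₀ : ∀ {a b} {s : End a} {t : End b} → s ≈[ 0ℤ ] t → t ≈[ 0ℤ ] s
  ≈-sym₀ = ≈-sym

  ≈-transˡ : ∀ {c a b e} {s : End a} {t : End b} {u : End e} → s ≈[ 0ℤ ] t → t ≈[ c ] u → s ≈[ c ] u
  ≈-transˡ {c} p q = subst (λ c → _ ≈[ c ] _) (ℤₚ.+-identityˡ c) (≈-trans p q)

  ≈-transʳ : ∀ {c a b e} {s : End a} {t : End b} {u : End e} → s ≈[ c ] t → t ≈[ 0ℤ ] u → s ≈[ c ] u
  ≈-transʳ {c} p q = subst (λ c → _ ≈[ c ] _) (ℤₚ.+-identityʳ c) (≈-trans p q)

  ≈-recompute : ∀ {c a b} {s : End a} {t : End b} → s ≈[ c ] t → c ≡ ht s ℤ.- ht t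
  ≈-recompute {c} {s = s} {t} (_ ,≈ q) = trans (lem c (ht t)) (cong (ℤ._- ht t) (sym q))
    where
    lem : ∀ c z → c ≡ (c ℤ.+ z) ℤ.- z
    lem = solve-∀

  pts⇒≈ : ∀ {a b} {s : End a} {t : End b} → (∀ i → seq s i ≡ seq t i) → s ≈[ ht s ℤ.- ht t ] t
  pts⇒≈ {s = s} {t} p = p ,≈ lem (ht s) (ht t)
    where
    lem : ∀ x y → x ≡ (x ℤ.- y) ℤ.+ y
    lem = solve-∀

  ≈-hts : ∀ {a b} {s : End a} {t : End b} → s ≈[ 0ℤ ] t → ht s ≡ ht t
  ≈-hts (_ ,≈ q) = trans q (ℤₚ.+-identityˡ _)

  -- Prepending k to the ray s, with cancellation when s starts by walking to k.
  data Pushed {a k : Vx K} (s : End a) (t : End k) : Set where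
    back  : k ≡ seq s 1 → (∀ i → seq t i ≡ seq s (suc i)) → ht t ≡ -1ℤ ℤ.+ ht s → Pushed s t
    forth : k ≢ seq s 1 → (∀ i → seq t (suc i) ≡ seq s i) → ht t ≡ 1ℤ ℤ.+ ht s → Pushed s t

  push-with : ∀ {a k} (s : End a) → E K a k → Dec (k ≡ seq s 1) → End k
  push-with s e (yes eq) = record
    { seq = λ i → seq s (suc i) ; ht = -1ℤ ℤ.+ ht s ; origin = sym eq
    ; adj = λ i → adj s (suc i) ; red = λ i → red s (suc i) }
  push-with {a} {k} s e (no k≢) = record
    { seq = λ { zero → k ; (suc i) → seq s i } ; ht = 1ℤ ℤ.+ ht s ; origin = refl
    ; adj = λ { zero → subst (E K k) (sym (origin s)) (symm K e) ; (suc i) → adj s i }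
    ; red = λ { zero → k≢ ; (suc i) → red s i } }

  push-with-view : ∀ {a k} (s : End a) (e : E K a k) d → Pushed s (push-with s e d)
  push-with-view s e (yes eq) = back eq (λ _ → refl) refl
  push-with-view s e (no k≢) = forth k≢ (λ _ → refl) refl

  push : ∀ {a k} → E K a k → End a → End k
  push {k = k} e s = push-with s e (k ≟ seq s 1)

  view : ∀ {a k} (e : E K a k) (s : End a) → Pushed s (push e s)
  view {k = k} e s = push-with-view s e (k ≟ seq s 1)

  private
    swap+ : ∀ x c z → x ℤ.+ (c ℤ.+ z) ≡ c ℤ.+ (x ℤ.+ z)
    swap+ = solve-∀

  push-cong : ∀ {a b k l c} {e : E K a k} {e′ : E K b l} {s : End a} {t : End b} →
              k ≡ l → s ≈[ c ] t → push e s ≈[ c ] push e′ t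
  push-cong {k = k} {l} {c} {e} {e′} {s} {t} k≡l (p ,≈ q) with push e s | view e s | push e′ t | view e′ t
  ... | _ | back x ps hs  | _ | back x′ pt ht′  =
    (λ i → trans (ps i) (trans (p (suc i)) (sym (pt i)))) ,≈
    trans hs (trans (cong (λ z → -1ℤ ℤ.+ z) q) (trans (swap+ -1ℤ c _) (cong (λ z → c ℤ.+ z) (sym ht′))))
  ... | _ | back x ps hs  | _ | forth x′ pt ht′ = contradiction (trans (sym k≡l) (trans x (p 1))) x′
  ... | _ | forth x ps hs | _ | back x′ pt ht′  = contradiction (trans k≡l (trans x′ (sym (p 1)))) x
  ... | ss | forth x ps hs | tt | forth x′ pt ht′ =
    (λ { zero → trans (origin ss) (trans k≡l (sym (origin tt)))
       ; (suc i) → trans (ps i) (trans (p i) (sym (pt i))) }) ,≈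
    trans hs (trans (cong (λ z → 1ℤ ℤ.+ z) q) (trans (swap+ 1ℤ c _) (cong (λ z → c ℤ.+ z) (sym ht′))))

  push-push : ∀ {a k b} {e : E K a k} {e′ : E K k b} {s : End a} → b ≡ a → push e′ (push e s) ≈[ 0ℤ ] s
  push-push {a} {k} {b} {e} {e′} {s} b≡a with push e s | view e s
  ... | t | back x p h with push e′ t | view e′ t
  -- Two cancellations in a row would force `seq s 0 ≡ seq s 2`.
  ...   | u | back y p′ h′  = contradiction (trans (origin s) (trans (sym b≡a) (trans y (p 1)))) (red s 0)
  ...   | u | forth y p′ h′ =
    (λ { zero → trans (origin u) (trans b≡a (sym (origin s)))
       ; (suc i) → trans (p′ i) (p i) }) ,≈ trans h′ (trans (cong (λ z → 1ℤ ℤ.+ z) h) (lem (ht s)))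
    where
    lem : ∀ z → 1ℤ ℤ.+ (-1ℤ ℤ.+ z) ≡ 0ℤ ℤ.+ z
    lem = solve-∀
  push-push {a} {k} {b} {e} {e′} {s} b≡a | t | forth x p h with push e′ t | view e′ t
  ...   | u | back y p′ h′  =
    (λ i → trans (p′ i) (p i)) ,≈ trans h′ (trans (cong (λ z → -1ℤ ℤ.+ z) h) (lem (ht s)))
    where
    lem : ∀ z → -1ℤ ℤ.+ (1ℤ ℤ.+ z) ≡ 0ℤ ℤ.+ z
    lem = solve-∀
  ...   | u | forth y p′ h′ = contradiction (trans b≡a (trans (sym (origin s)) (sym (p 0)))) y

  push-injective : ∀ {a b k l c} {e : E K a k} {e′ : E K b l} {s : End a} {t : End b} →
                   a ≡ b → k ≡ l → push e s ≈[ c ] push e′ t → s ≈[ c ] t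
  push-injective {e = e} {e′} a≡b k≡l p =
    ≈-transˡ (≈-sym₀ (push-push {e′ = symm K e} refl))
      (≈-transʳ (push-cong {e′ = symm K e′} a≡b p) (push-push refl))

  Diverge : ∀ {a b} → ℕ → End a → End b → Set
  Diverge n s t = (∀ i → i ≤ n → seq s i ≡ seq t i) × seq s (suc n) ≢ seq t (suc n)

  diverge-unique : ∀ {a b m n} {s : End a} {t : End b} → Diverge m s t → Diverge n s t → m ≡ n
  diverge-unique {m = m} {n} (p , q) (p′ , q′) with ℕₚ.<-cmp m n
  ... | tri< m<n _ _ = contradiction (p′ _ m<n) q

  ... | tri≈ _ eq _  = eq
  ... | tri> _ _ n<m = contradiction (p _ n<m) q′

  diverge-from : ∀ {a b} (s : End a) (t : End b) → a ≡ b → ∀ i → seq s i ≢ seq t i → ∃ λ n → Diverge n s t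
  diverge-from s t a≡b i neq with agreeUpTo i
    where
    agreeUpTo : ∀ m → (∀ i → i ≤ m → seq s i ≡ seq t i) ⊎ ∃ λ n → Diverge n s t
    agreeUpTo zero = inj₁ λ { zero _ → trans (origin s) (trans a≡b (sym (origin t))) }
    agreeUpTo (suc m) with agreeUpTo m
    ... | inj₂ d = inj₂ d
    ... | inj₁ p with seq s (suc m) ≟ seq t (suc m)
    ... | no neq   = inj₂ (m , p , neq)
    ... | yes eq = inj₁ extend
      where
      extend : ∀ i → i ≤ suc m → seq s i ≡ seq t i
      extend i i≤ with ℕₚ.m≤n⇒m<n∨m≡n i≤
      ... | inj₁ (s≤s i≤m) = p i i≤m
      ... | inj₂ refl      = eq
  ... | inj₁ p = contradiction (p i ℕₚ.≤-refl) neq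
  ... | inj₂ d = d

  -- Invariant under pushing: on either side of the branching point, a push changes n by the
  -- average of the changes of the two heights.
  excess : ∀ {a b} → ℕ → End a → End b → ℤ
  excess n s t = (ht s ℤ.+ ht t) ℤ.- (+ n ℤ.+ + n)

  push-diverge : ∀ {a k n} (e : E K a k) (s t : End a) → Diverge n s t →
                 ∃ λ m → Diverge m (push e s) (push e t) × excess m (push e s) (push e t) ≡ excess n s t
  push-diverge {a} {k} {n} e s t (p , q) with push e s | view e s | push e t | view e t
  push-diverge {n = zero} e s t (p , q) | s′ | back x ps hs | t′ | back y pt ht′ =
    contradiction (trans (sym x) y) q
  push-diverge {n = suc n} e s t (p , q) | s′ | back x ps hs | t′ | back y pt ht′ =
    n , ((λ i i≤ → trans (ps i) (trans (p (suc i) (s≤s i≤)) (sym (pt i)))) ,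
         (λ eq → q (trans (sym (ps (suc n))) (trans eq (pt (suc n)))))) ,
    trans (cong (ℤ._- (+ n ℤ.+ + n)) (cong₂ ℤ._+_ hs ht′)) (lem (ht s) (ht t) (+ n))
    where
    lem : ∀ x y n → ((-1ℤ ℤ.+ x) ℤ.+ (-1ℤ ℤ.+ y)) ℤ.- (n ℤ.+ n) ≡ (x ℤ.+ y) ℤ.- ((1ℤ ℤ.+ n) ℤ.+ (1ℤ ℤ.+ n))
    lem = solve-∀
  push-diverge {n = n} e s t (p , q) | s′ | forth x ps hs | t′ | forth y pt ht′ =
    suc n , ((λ { zero _ → trans (origin s′) (sym (origin t′))
                ; (suc i) (s≤s i≤) → trans (ps i) (trans (p i i≤) (sym (pt i))) }) ,
             (λ eq → q (trans (sym (ps (suc n))) (trans eq (pt (suc n)))))) ,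
    trans (cong (ℤ._- (+ suc n ℤ.+ + suc n)) (cong₂ ℤ._+_ hs ht′)) (lem (ht s) (ht t) (+ n))
    where
    lem : ∀ x y n → ((1ℤ ℤ.+ x) ℤ.+ (1ℤ ℤ.+ y)) ℤ.- ((1ℤ ℤ.+ n) ℤ.+ (1ℤ ℤ.+ n)) ≡ (x ℤ.+ y) ℤ.- (n ℤ.+ n)
    lem = solve-∀
  push-diverge {n = suc n} e s t (p , q) | s′ | back x ps hs | t′ | forth y pt ht′ =
    contradiction (trans x (p 1 (s≤s z≤n))) y
  push-diverge {n = suc n} e s t (p , q) | s′ | forth x ps hs | t′ | back y pt ht′ =
    contradiction (trans y (sym (p 1 (s≤s z≤n)))) x
  -- Only at the branching point can one push cancel while the other extends; the index and the sum
  -- of the heights are then both unchanged.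
  push-diverge {n = zero} e s t (p , q) | s′ | back x ps hs | t′ | forth y pt ht′ =
    0 , ((λ { zero _ → trans (origin s′) (sym (origin t′)) }) ,
         (λ eq → red s 0 (trans (p 0 z≤n) (trans (sym (pt 0)) (trans (sym eq) (ps 1)))))) ,
    trans (cong (ℤ._- 0ℤ) (cong₂ ℤ._+_ hs ht′)) (lem (ht s) (ht t))
    where
    lem : ∀ x y → ((-1ℤ ℤ.+ x) ℤ.+ (1ℤ ℤ.+ y)) ℤ.- 0ℤ ≡ (x ℤ.+ y) ℤ.- 0ℤ
    lem = solve-∀
  push-diverge {n = zero} e s t (p , q) | s′ | forth x ps hs | t′ | back y pt ht′ =
    0 , ((λ { zero _ → trans (origin s′) (sym (origin t′)) }) ,
         (λ eq → red t 0 (trans (sym (p 0 z≤n)) (trans (sym (ps 0)) (trans eq (pt 1)))))) ,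
    trans (cong (ℤ._- 0ℤ) (cong₂ ℤ._+_ hs ht′)) (lem (ht s) (ht t))
    where
    lem : ∀ x y → ((1ℤ ℤ.+ x) ℤ.+ (-1ℤ ℤ.+ y)) ℤ.- 0ℤ ≡ (x ℤ.+ y) ℤ.- 0ℤ
    lem = solve-∀

  -- Eventually periodic rays

  Periodic : ∀ {a} → ℕ → ℕ → End a → Set
  Periodic d p s = ∀ i → d ≤ i → seq s (p ℕ.+ i) ≡ seq s i

  push-periodic : ∀ {a k d p} (e : E K a k) (s : End a) → Periodic d p s → Periodic (suc d) p (push e s)
  push-periodic {d = d} {p} e s per with push e s | view e s
  ... | t | back x ps _ = λ i d<i →
    trans (ps (p ℕ.+ i)) (trans (cong (seq s) (sym (ℕₚ.+-suc p i)))
      (trans (per (suc i) (ℕₚ.≤-trans (ℕₚ.n≤1+n d) (ℕₚ.m≤n⇒m≤1+n d<i))) (sym (ps i))))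
  ... | t | forth x ps _ = λ { (suc i) (s≤s d≤i) →
    trans (cong (seq t) (ℕₚ.+-suc p i)) (trans (ps (p ℕ.+ i)) (trans (per i d≤i) (sym (ps i)))) }

  -- Subtracting `p` repeatedly brings every index into the initial segment where the rays are known
  -- to agree. This makes equality of eventually periodic rays decidable.
  periodic-agree : ∀ {a b d p} {s : End a} {t : End b} → 1 ≤ p → Periodic d p s → Periodic d p t →
                   (∀ i → i ≤ p ℕ.+ d → seq s i ≡ seq t i) → ∀ i → seq s i ≡ seq t i
  periodic-agree {d = d} {p} {s} {t} 1≤p ps pt agree = λ i → go i i ℕₚ.≤-refl
    where
    go : ∀ fuel i → i ≤ fuel → seq s i ≡ seq t i
    go fuel i i≤ with i ℕ.≤? p ℕ.+ d
    ... | yes small = agree i small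
    go zero i z≤n | no ¬small = contradiction z≤n ¬small
    go (suc fuel) i i≤ | no ¬small =
      trans (cong (seq s) (sym i≡)) (trans (ps j d≤j) (trans (go fuel j j≤) (trans (sym (pt j d≤j)) (cong (seq t) i≡))))
      where
      j = i ℕ.∸ p
      big : p ℕ.+ d ≤ i
      big = ℕₚ.<⇒≤ (ℕₚ.≰⇒> ¬small)
      i≡ : p ℕ.+ j ≡ i
      i≡ = ℕₚ.m+[n∸m]≡n (ℕₚ.≤-trans (ℕₚ.m≤m+n p d) big)
      d≤j : d ≤ j
      d≤j = ℕₚ.≤-trans (ℕₚ.≤-reflexive (sym (ℕₚ.m+n∸m≡n p d))) (ℕₚ.∸-monoˡ-≤ p big)
      j≤ : j ≤ fuel
      j≤ = ℕₚ.≤-pred (ℕₚ.≤-trans (ℕₚ.≤-trans (ℕₚ.+-monoˡ-≤ j 1≤p) (ℕₚ.≤-reflexive i≡)) i≤)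

  agree? : ∀ {a b} (s : End a) (t : End b) m → Dec (∀ i → i ≤ m → seq s i ≡ seq t i)
  agree? s t zero with seq s 0 ≟ seq t 0
  ... | yes eq = yes λ { zero _ → eq }
  ... | no neq  = no λ p → neq (p 0 z≤n)
  agree? s t (suc m) with agree? s t m | seq s (suc m) ≟ seq t (suc m)
  ... | no ¬p | _     = no λ p → ¬p λ i i≤ → p i (ℕₚ.m≤n⇒m≤1+n i≤)
  ... | yes _ | no neq  = no λ p → neq (p (suc m) ℕₚ.≤-refl)
  ... | yes p | yes q = yes λ i i≤ → extend i (ℕₚ.m≤n⇒m<n∨m≡n i≤)
    where
    extend : ∀ i → i ℕ.< suc m ⊎ i ≡ suc m → seq s i ≡ seq t i
    extend i (inj₁ (s≤s i≤)) = p i i≤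
    extend _ (inj₂ refl)     = q

  periodic-weaken : ∀ {a d d′ p} {s : End a} → d ≤ d′ → Periodic d p s → Periodic d′ p s
  periodic-weaken d≤ per i d′≤i = per i (ℕₚ.≤-trans d≤ d′≤i)

  pts? : ∀ {a b d d′ p} {s : End a} {t : End b} → 1 ≤ p → Periodic d p s → Periodic d′ p t →
         Dec (∀ i → seq s i ≡ seq t i)
  pts? {d = d} {d′} {p} {s} {t} 1≤p ps pt with agree? s t (p ℕ.+ (d ℕ.⊔ d′))
  ... | yes q = yes (periodic-agree {s = s} {t} 1≤p (periodic-weaken {s = s} (ℕₚ.m≤m⊔n d d′) ps)
                       (periodic-weaken {s = t} (ℕₚ.m≤n⊔m d d′) pt) q)
  ... | no ¬q = no λ q → ¬q λ i _ → q i

  periodic-shift : ∀ {a} {s : End a} r m → (∀ i → seq s (m ℕ.+ i) ≡ seq s (r ℕ.+ i)) → r ≤ m → Periodic r (m ℕ.∸ r) s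
  periodic-shift {s = s} r m eq r≤m i r≤i = trans (cong (seq s) index) (trans (eq (i ℕ.∸ r)) (cong (seq s) (ℕₚ.m+[n∸m]≡n r≤i)))
    where
    open ≡-Reasoning
    index : (m ℕ.∸ r) ℕ.+ i ≡ m ℕ.+ (i ℕ.∸ r)
    index = begin
      (m ℕ.∸ r) ℕ.+ i                   ≡⟨ cong ((m ℕ.∸ r) ℕ.+_) (sym (ℕₚ.m+[n∸m]≡n r≤i)) ⟩
      (m ℕ.∸ r) ℕ.+ (r ℕ.+ (i ℕ.∸ r))   ≡⟨ sym (ℕₚ.+-assoc (m ℕ.∸ r) r _) ⟩
      (m ℕ.∸ r) ℕ.+ r ℕ.+ (i ℕ.∸ r)     ≡⟨ cong (ℕ._+ (i ℕ.∸ r)) (ℕₚ.m∸n+n≡m r≤m) ⟩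
      m ℕ.+ (i ℕ.∸ r)                   ∎

  -- The action of walks on ends

  module Action {R : RawGraph} (f : Hom R (raw K)) where

    act : ∀ {b x y} → Wk R b x y → End (fun f x) → End (fun f y)
    act nil        s = s
    act (step e w) s = act w (push (pres f e) s)

    act-cong : ∀ {b x y c} (w : Wk R b x y) {s t} → s ≈[ c ] t → act w s ≈[ c ] act w t
    act-cong nil        p = p
    act-cong (step e w) p = act-cong w (push-cong refl p)

    act-injective : ∀ {b x y c} (w : Wk R b x y) {s t} → act w s ≈[ c ] act w t → s ≈[ c ] t
    act-injective nil        p = p
    act-injective (step e w) p = push-injective refl refl (act-injective w p)

    act-++ : ∀ {b c x y z} (v : Wk R b x y) (w : Wk R c y z) s → act (v ++ w) s ≈[ 0ℤ ] act w (act v s)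
    act-++ nil w s = ≈-refl
    act-++ {b = false}             (step e v) w s = act-++ v w (push (pres f e) s)
    act-++ {b = true} {c = false}  (step e v) w s = act-++ v w (push (pres f e) s)
    act-++ {b = true} {c = true}   (step e v) w s = act-++ v w (push (pres f e) s)

    act-diverge : ∀ {b x y n} (w : Wk R b x y) s t → Diverge n s t →
                  ∃ λ m → Diverge m (act w s) (act w t) × excess m (act w s) (act w t) ≡ excess n s t
    act-diverge nil        s t d = _ , d , refl
    act-diverge (step e w) s t d =
      let (_ , d₁ , eq₁) = push-diverge (pres f e) s t d
          (m , d₂ , eq₂) = act-diverge w _ _ d₁
      in m , d₂ , trans eq₂ eq₁

    -- A closed walk is a translation of the universal cover: it fixes only its two ends,
    -- and moves the heights along them by opposite amounts.
    fixed-unique : ∀ {b x c} (w : Wk R b x x) (s t : End (fun f x)) → c ≢ 0ℤ →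
                   act w s ≈[ c ] s → act w t ≈[ c ] t → ∀ i → seq s i ≡ seq t i
    fixed-unique {c = c} w s t c≢0 p q i with seq s i ≟ seq t i
    ... | yes eq = eq
    ... | no neq with diverge-from s t refl i neq
    ... | n , d with act-diverge w s t d
    ... | m , (d₁ , d₂) , eq with diverge-unique {m = m} {n} {s} {t}
                                ((λ j j≤ → trans (sym (pts p j)) (trans (d₁ j j≤) (pts q j))) ,
                                 (λ eq → d₂ (trans (pts p _) (trans eq (sym (pts q _)))))) d
    -- The branching index is unchanged while both heights gain `c`, so the invariance of `excess`
    -- forces `c + c` to vanish.
    ... | refl = contradiction (double-zero c (cancel c (ht s ℤ.+ ht t) (+ n) zero-shift)) c≢0
      where
      reorder : ∀ c x y n → ((c ℤ.+ x) ℤ.+ (c ℤ.+ y)) ℤ.- n ≡ (c ℤ.+ c) ℤ.+ ((x ℤ.+ y) ℤ.- n)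
      reorder = solve-∀
      zero-shift : (c ℤ.+ c) ℤ.+ ((ht s ℤ.+ ht t) ℤ.- (+ n ℤ.+ + n)) ≡ (ht s ℤ.+ ht t) ℤ.- (+ n ℤ.+ + n)
      zero-shift = trans (sym (reorder c (ht s) (ht t) (+ n ℤ.+ + n)))
        (trans (cong (ℤ._- (+ n ℤ.+ + n)) (cong₂ ℤ._+_ (sym (hts p)) (sym (hts q)))) eq)
      cancel : ∀ c z n → (c ℤ.+ c) ℤ.+ (z ℤ.- (n ℤ.+ n)) ≡ z ℤ.- (n ℤ.+ n) → c ℤ.+ c ≡ 0ℤ
      cancel c z n eq = trans (lem c (z ℤ.- (n ℤ.+ n))) (trans (cong (ℤ._- (z ℤ.- (n ℤ.+ n))) eq) (ℤₚ.+-inverseʳ (z ℤ.- (n ℤ.+ n))))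
        where
        lem : ∀ c z → c ℤ.+ c ≡ ((c ℤ.+ c) ℤ.+ z) ℤ.- z
        lem = solve-∀

    act-periodic : ∀ {b x y d p} (w : Wk R b x y) s → Periodic d p s → ∃ λ d′ → Periodic d′ p (act w s)
    act-periodic nil        s per = _ , per
    act-periodic (step e w) s per = act-periodic w _ (push-periodic (pres f e) s per)

    -- A finite walk alters only an initial segment: it removes `m` points of the ray and puts `r`
    -- new ones in front. In `go`, `t` is the current ray and `s` the original one.
    act-tails : ∀ {b x y} (w : Wk R b x y) s → ∃₂ λ r m →
                (∀ i → seq (act w s) (r ℕ.+ i) ≡ seq s (m ℕ.+ i)) × ht (act w s) ≡ (+ r ℤ.- + m) ℤ.+ ht s
    act-tails w s = go w s s 0 0 (λ _ → refl) (sym (ℤₚ.+-identityˡ _))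
      where
      go : ∀ {a b x y} (w : Wk R b x y) (s : End a) t r m →
           (∀ i → seq t (r ℕ.+ i) ≡ seq s (m ℕ.+ i)) → ht t ≡ (+ r ℤ.- + m) ℤ.+ ht s →
           ∃₂ λ r m → (∀ i → seq (act w t) (r ℕ.+ i) ≡ seq s (m ℕ.+ i)) × ht (act w t) ≡ (+ r ℤ.- + m) ℤ.+ ht s
      go nil s t r m eq h = r , m , eq , h
      go (step e w) s t r m eq h with push (pres f e) t | view (pres f e) t
      ... | t′ | forth _ ps h′ = go w s t′ (suc r) m (λ i → trans (ps (r ℕ.+ i)) (eq i))
        (trans h′ (trans (cong (λ z → 1ℤ ℤ.+ z) h) (lem (+ r) (+ m) (ht s))))
        where
        lem : ∀ r m z → 1ℤ ℤ.+ ((r ℤ.- m) ℤ.+ z) ≡ ((1ℤ ℤ.+ r) ℤ.- m) ℤ.+ z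
        lem = solve-∀
      go (step e w) s t zero m eq h | t′ | back _ ps h′ = go w s t′ zero (suc m)
        (λ i → trans (ps i) (trans (eq (suc i)) (cong (seq s) (ℕₚ.+-suc m i))))
        (trans h′ (trans (cong (λ z → -1ℤ ℤ.+ z) h) (lem (+ m) (ht s))))
        where
        lem : ∀ m z → -1ℤ ℤ.+ ((0ℤ ℤ.- m) ℤ.+ z) ≡ (0ℤ ℤ.- (1ℤ ℤ.+ m)) ℤ.+ z
        lem = solve-∀
      go (step e w) s t (suc r) m eq h | t′ | back _ ps h′ = go w s t′ r m
        (λ i → trans (ps (r ℕ.+ i)) (eq i))
        (trans h′ (trans (cong (λ z → -1ℤ ℤ.+ z) h) (lem (+ r) (+ m) (ht s))))
        where
        lem : ∀ r m z → -1ℤ ℤ.+ (((1ℤ ℤ.+ r) ℤ.- m) ℤ.+ z) ≡ (r ℤ.- m) ℤ.+ z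
        lem = solve-∀

    -- As `c` is nonzero, the two lengths from `act-tails` differ, so from some point on the ray
    -- agrees with a proper shift of itself.
    fixed-periodic : ∀ {b x c} (w : Wk R b x x) (s : End (fun f x)) → c ≢ 0ℤ → act w s ≈[ c ] s →
                     ∃₂ λ d p → 1 ≤ p × Periodic d p s
    fixed-periodic {c = c} w s c≢0 fix with act-tails w s
    ... | r , m , eq , h with ℕₚ.<-cmp r m
    ... | tri≈ _ refl _ = contradiction
      (trans (≈-recompute fix) (trans (cong (ℤ._- ht s) h) (lem (+ r) (ht s)))) c≢0
      where
      lem : ∀ r z → ((r ℤ.- r) ℤ.+ z) ℤ.- z ≡ 0ℤ
      lem = solve-∀
    ... | tri< r<m _ _ = r , m ℕ.∸ r , ℕₚ.m<n⇒0<n∸m r<m ,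
      periodic-shift {s = s} r m (λ i → trans (sym (eq i)) (pts fix (r ℕ.+ i))) (ℕₚ.<⇒≤ r<m)
    ... | tri> _ _ m<r = m , r ℕ.∸ m , ℕₚ.m<n⇒0<n∸m m<r ,
      periodic-shift {s = s} m r (λ i → trans (sym (pts fix (r ℕ.+ i))) (eq i)) (ℕₚ.<⇒≤ m<r)

-- Ends fixed by odd closed walks

suc-% : ∀ i n → suc i % suc n ≡ suc (i % suc n) % suc n
suc-% i n = trans (%-distribˡ-+ 1 i (suc n))
  (trans (cong (λ j → (1 % suc n ℕ.+ j) % suc n) (sym (m%n%n≡m%n i (suc n))))
         (sym (%-distribˡ-+ 1 (i % suc n) (suc n))))

module Words (K : Graph) where
  open Ends K

  Adjacent : (ℕ → Vx K) → ℕ → Set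
  Adjacent f n = ∀ i → i ℕ.< n → E K (f i) (f (suc i))

  NonBacktracking : (ℕ → Vx K) → ℕ → Set
  NonBacktracking f n = ∀ i → suc (suc i) ≤ n → f i ≢ f (suc (suc i))

  tailAdj : ∀ {f n} → Adjacent f (suc n) → Adjacent (f ∘ suc) n
  tailAdj adj i i< = adj (suc i) (s≤s i<)

  initAdj : ∀ {f n} → Adjacent f (suc n) → Adjacent f n
  initAdj adj i i< = adj i (ℕₚ.m≤n⇒m≤1+n i<)

  -- Reduced words are walks of K that need not come from walks of the coloured graph, so they act
  -- as sequences of colours. Only the values of `f` up to `n` matter, and stripping the first
  -- letter is composition with `suc`.
  actWord : ∀ f n → Adjacent f n → End (f 0) → End (f n)
  actWord f zero    adj s = s
  actWord f (suc n) adj s = actWord (f ∘ suc) n (tailAdj adj) (push (adj 0 (s≤s z≤n)) s)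

  actWord-cong : ∀ {c} f n (adj adj′ : Adjacent f n) {s t} → s ≈[ c ] t → actWord f n adj s ≈[ c ] actWord f n adj′ t
  actWord-cong f zero    adj adj′ p = p
  actWord-cong f (suc n) adj adj′ p = actWord-cong (f ∘ suc) n _ _ (push-cong refl p)

  actWord-last : ∀ f n (adj : Adjacent f (suc n)) s →
    actWord f (suc n) adj s ≈[ 0ℤ ] push (adj n ℕₚ.≤-refl) (actWord f n (initAdj adj) s)
  actWord-last f zero    adj s = push-cong refl ≈-refl
  actWord-last f (suc n) adj s =
    ≈-transʳ (actWord-last (f ∘ suc) n (tailAdj adj) (push (adj 0 (s≤s z≤n)) s))
      (push-cong refl (actWord-cong (f ∘ suc) n (initAdj (tailAdj adj)) (tailAdj (initAdj adj)) (push-cong refl ≈-refl)))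

  odd : ℕ → Bool
  odd zero    = false
  odd (suc n) = not (odd n)

  module _ {R : RawGraph} (h : Hom R (raw K)) where
    open Action h

    -- Free reduction in K. A cancellation removes two letters, so the parity survives, and an odd
    -- closed walk never reduces to the empty word.
    record Reduction {b x y} (w : Wk R b x y) : Set where
      field
        word   : ℕ → Vx K
        len    : ℕ
        first  : word 0 ≡ fun h x
        last   : word len ≡ fun h y
        parity : odd len ≡ b
        adjs   : Adjacent word len
        reds   : NonBacktracking word len
        acts   : ∀ {s t} → s ≈[ 0ℤ ] t → act w s ≈[ 0ℤ ] actWord word len adjs t
    open Reduction

    extend : ∀ {b x y z} (e : Adj R x y) {w : Wk R (not b) y z} (r : Reduction w) →
             (1 ≤ len r → fun h x ≢ word r 1) → Reduction {b} (step e w)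
    extend {b} {x} e {w} r x≢ = record
      { word = f ; len = suc (len r) ; first = refl ; last = last r
      ; parity = trans (cong not (parity r)) (Boolₚ.not-involutive b)
      ; adjs = adjf ; reds = λ { zero (s≤s 1≤) → x≢ 1≤ ; (suc i) (s≤s i≤) → reds r i i≤ }
      ; acts = λ p → acts r (push-cong (sym (first r)) p) }
      where
      f : ℕ → Vx K
      f zero    = fun h x
      f (suc i) = word r i
      adjf : Adjacent f (suc (len r))
      adjf zero    _        = subst (E K (fun h x)) (sym (first r)) (pres h e)
      adjf (suc i) (s≤s i<) = adjs r i i<

    reduce : ∀ {b x y} (w : Wk R b x y) → Reduction w
    reduce {x = x} nil = record
      { word = λ _ → fun h x ; len = 0 ; first = refl ; last = refl ; parity = refl
      ; adjs = λ _ () ; reds = λ _ () ; acts = λ p → p }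
    reduce {b} {x} (step e w) with reduce w
    ... | r@record { len = zero } = extend e r λ ()
    ... | r@record { word = f ; len = suc m } with fun h x ≟ f 1
    ...   | no neq = extend e r λ _ → neq
    ...   | yes eq = record
      { word = f ∘ suc ; len = m ; first = sym eq ; last = last r
      ; parity = trans (sym (Boolₚ.not-involutive (odd m))) (trans (cong not (parity r)) (Boolₚ.not-involutive b))
      ; adjs = λ i i< → adjs r (suc i) (s≤s i<)
      ; reds = λ i i< → reds r (suc i) (s≤s i<)
      ; acts = λ p → ≈-transʳ (acts r (push-cong {e′ = symm K (adjs r 0 (s≤s z≤n))} (sym (first r)) p))
                        (actWord-cong (f ∘ suc) m _ _ (push-push refl)) }

  -- Each letter is the next point of the ray, so every push is a cancellation.
  follow : ∀ f n (adj : Adjacent f n) (s : End (f 0)) → (∀ i → i ≤ n → f i ≡ seq s i) →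
           (∀ i → seq (actWord f n adj s) i ≡ seq s (n ℕ.+ i)) × ht (actWord f n adj s) ≡ (- + n) ℤ.+ ht s
  follow f zero    adj s on = (λ _ → refl) , sym (ℤₚ.+-identityˡ _)
  follow f (suc n) adj s on with push (adj 0 (s≤s z≤n)) s | view (adj 0 (s≤s z≤n)) s
  ... | t | forth neq _ _ = contradiction (on 1 (s≤s z≤n)) neq
  ... | t | back _ ps h with follow (f ∘ suc) n (tailAdj adj) t
                               (λ i i≤ → trans (on (suc i) (s≤s i≤)) (sym (ps i)))
  ...   | pts′ , hts′ = (λ i → trans (pts′ i) (ps (n ℕ.+ i))) ,
    trans hts′ (trans (cong (λ z → (- + n) ℤ.+ z) h) (lem (+ n) (ht s)))
    where
    lem : ∀ n z → (- n) ℤ.+ (-1ℤ ℤ.+ z) ≡ (- (1ℤ ℤ.+ n)) ℤ.+ z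
    lem = solve-∀

  -- By `turn` the closed word is cyclically reduced. Running round it forever therefore gives a
  -- reduced ray, and acting by the word strips one lap of `n + 1` points.
  module Cycle (f : ℕ → Vx K) (n : ℕ) (adjf : Adjacent f (suc n)) (redf : NonBacktracking f (suc n))
    (closed : f (suc n) ≡ f 0) (turn : f 1 ≢ f n) where

    around : ℕ → Vx K
    around i = f (i % suc n)

    wrap : ∀ i → suc (i % suc n) ℕ.< suc n × suc i % suc n ≡ suc (i % suc n) ⊎ i % suc n ≡ n × suc i % suc n ≡ 0
    wrap i with ℕₚ.m≤n⇒m<n∨m≡n (m%n<n i (suc n))
    ... | inj₁ lt = inj₁ (lt , trans (suc-% i n) (m<n⇒m%n≡m lt))
    ... | inj₂ eq = inj₂ (ℕₚ.suc-injective eq , trans (suc-% i n) (trans (cong (_% suc n) eq) (n%n≡0 (suc n))))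

    around-suc : ∀ i → around (suc i) ≡ f (suc (i % suc n))
    around-suc i with wrap i
    ... | inj₁ (_ , eq)   = cong f eq
    ... | inj₂ (eq , eq′) = trans (cong f eq′) (trans (sym closed) (cong (f ∘ suc) (sym eq)))

    cycleEnd : End (f 0)
    cycleEnd = record
      { seq = around ; ht = 0ℤ ; origin = refl
      ; adj = λ i → subst (E K (around i)) (sym (around-suc i)) (adjf _ (m%n<n i (suc n)))
      ; red = redAround }
      where
      redAround : ∀ i → around i ≢ around (suc (suc i))
      redAround i eq with wrap i
      ... | inj₁ (lt , p) = redf _ lt (trans eq (trans (around-suc (suc i)) (cong (f ∘ suc) p)))
      ... | inj₂ (p , q)  = turn (sym (trans (cong f (sym p)) (trans eq (trans (around-suc (suc i)) (cong (f ∘ suc) q)))))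

    cycleEnd-fixed : actWord f (suc n) adjf cycleEnd ≈[ -[1+ n ] ] cycleEnd
    cycleEnd-fixed with follow f (suc n) adjf cycleEnd on
      where
      on : ∀ i → i ≤ suc n → f i ≡ around i
      on i i≤ with ℕₚ.m≤n⇒m<n∨m≡n i≤
      ... | inj₁ lt   = cong f (sym (m<n⇒m%n≡m lt))
      ... | inj₂ refl = trans closed (cong f (sym (n%n≡0 (suc n))))
    ... | p , h = (λ i → trans (p i) (cong f (trans (cong (_% suc n) (ℕₚ.+-comm (suc n) i)) ([m+n]%n≡m%n i (suc n))))) ,≈ h

  -- A word that backtracks at its base point is a conjugate of a word shorter by two letters; the
  -- end fixed by the inner word is pushed across the first edge. Length one would give a loop of K,
  -- and length two contradicts reducedness.
  reducedFixed : ∀ f n (adjf : Adjacent f (suc n)) → NonBacktracking f (suc n) → f (suc n) ≡ f 0 →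
                 Σ (End (f 0)) λ s → ∃ λ c → c ≢ 0ℤ × actWord f (suc n) adjf s ≈[ c ] s
  reducedFixed f n adjf redf closed with f 1 ≟ f n
  ... | no turn = cycleEnd , _ , (λ ()) , cycleEnd-fixed
    where open Cycle f n adjf redf closed turn
  reducedFixed f zero adjf redf closed | yes _ =
    contradiction (subst (E K (f 0)) closed (adjf 0 ℕₚ.≤-refl)) (loopless K (f 0))
  reducedFixed f (suc zero) adjf redf closed | yes _ = contradiction (sym closed) (redf 0 ℕₚ.≤-refl)
  reducedFixed f (suc (suc m)) adjf redf closed | yes eq
    with reducedFixed (f ∘ suc) m (initAdj (tailAdj adjf)) (λ i i< → redf (suc i) (s≤s (ℕₚ.m≤n⇒m≤1+n i<))) (sym eq)
  ... | s , c , c≢0 , fix = push (symm K e₀) s , c , c≢0 ,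
    ≈-transˡ (actWord-cong (f ∘ suc) (suc (suc m)) (tailAdj adjf) (tailAdj adjf) (push-push refl))
      (≈-transˡ (actWord-last (f ∘ suc) (suc m) (tailAdj adjf) s) (push-cong closed fix))
    where
    e₀ : E K (f 0) (f 1)
    e₀ = adjf 0 (s≤s z≤n)

  recast : ∀ {a b} → a ≡ b → End a → End b
  recast refl s = s

  recast-≈ : ∀ {a b} (eq : a ≡ b) s → recast eq s ≈[ 0ℤ ] s
  recast-≈ refl s = ≈-refl

  open Reduction

  oddFixed : ∀ {R : RawGraph} (h : Hom R (raw K)) {x} (w : Wk R true x x) → Σ (End (fun h x)) λ s →
             ∃ λ c → c ≢ 0ℤ × Action.act h w s ≈[ c ] s
  oddFixed h w with reduce h w
  ... | record { len = zero ; parity = () }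
  ... | r@record { word = f ; len = suc n } with reducedFixed f n (adjs r) (reds r) (trans (last r) (sym (first r)))
  ...   | s , c , c≢0 , fix = recast (first r) s , c , c≢0 ,
    ≈-transˡ (acts r (recast-≈ (first r) s)) (≈-transʳ fix (≈-sym₀ (recast-≈ (first r) s)))

-- Lifting walks of the factors

projG : ∀ {G H b x y} → Wk (G ⊗ H) b x y → Wk G b (proj₁ x) (proj₁ y)
projG nil        = nil
projG (step e w) = step (proj₁ e) (projG w)

projH : ∀ {G H b x y} → Wk (G ⊗ H) b x y → Wk H b (proj₂ x) (proj₂ y)
projH nil        = nil
projH (step e w) = step (proj₂ e) (projH w)

module Lifts (G H : Graph) where
  X : RawGraph
  X = raw G ⊗ raw H

  X-symm : ∀ {x y} → Adj X x y → Adj X y x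
  X-symm (e , f) = symm G e , symm H f

  liftG : ∀ {g g′ h k} → E H h k → Wk (raw G) false g g′ → Wk X false (g , h) (g′ , h)
  liftG f nil                 = nil
  liftG f (step a (step b A)) = step (a , f) (step (b , symm H f) (liftG f A))

  liftH : ∀ {g l h h′} → E G g l → Wk (raw H) false h h′ → Wk X false (g , h) (g , h′)
  liftH e nil                 = nil
  liftH e (step a (step b B)) = step (e , a) (step (symm G e , b) (liftH e B))

  nbG : ∀ g → E G g (proj₁ (noIsolated G g))
  nbG g = proj₂ (noIsolated G g)

  nbH : ∀ h → E H h (proj₁ (noIsolated H h))
  nbH h = proj₂ (noIsolated H h)

  combine : ∀ {b g g′ h h′} → Wk (raw G) b g g′ → Wk (raw H) b h h′ → Wk X b (g , h) (g′ , h′)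
  combine {false} A B                   = liftG (nbH _) A ++ liftH (nbG _) B
  combine {true}  (step a A) (step b B) = step (a , b) (combine A B)

module Squares (G H K : Graph) (sf : SquareFree K) (μ : Hom (raw G ⊗ raw H) (raw K)) where
  open Ends K public
  open Lifts G H public
  open Action μ public

  adjacent⇒≢ : ∀ {a b} → E K a b → a ≢ b
  adjacent⇒≢ e refl = loopless K _ e

  pushX : ∀ {x y} → Adj X x y → End (fun μ x) → End (fun μ y)
  pushX e = push (pres μ e)

  -- K has no square, so the image of a 4-cycle of G ⊗ H is degenerate.
  via : ∀ {x y z w} (e : Adj X x y) (e′ : Adj X y z) (f : Adj X x w) (f′ : Adj X w z) s →
        pushX e′ (pushX e s) ≈[ 0ℤ ] pushX f′ (pushX f s)
  via {x} {y} {z} {w} e e′ f f′ s with fun μ x ≟ fun μ z | fun μ y ≟ fun μ w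
  ... | yes eq | _ = ≈-trans (push-push (sym eq)) (≈-sym₀ (push-push (sym eq)))
  ... | no _   | yes eq = push-cong refl (push-cong eq ≈-refl)
  ... | no x≢z | no y≢w = contradiction (pres μ e , pres μ e′ , symm K (pres μ f′) , symm K (pres μ f))
    (sf _ _ _ _ (adjacent⇒≢ (pres μ e)) x≢z (adjacent⇒≢ (pres μ f))
      (adjacent⇒≢ (pres μ e′)) y≢w (adjacent⇒≢ (symm K (pres μ f′))))

  moveG : ∀ {g g₁ g₂ h k} → E H h k → E G g g₁ → E G g₁ g₂ → End (fun μ (g , h)) → End (fun μ (g₂ , h))
  moveG f a a′ s = pushX (a′ , symm H f) (pushX (a , f) s)

  moveH : ∀ {h h₁ h₂ g l} → E G g l → E H h h₁ → E H h₁ h₂ → End (fun μ (g , h)) → End (fun μ (g , h₂))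
  moveH e b b′ s = pushX (symm G e , b′) (pushX (e , b) s)

  moveG-cong : ∀ {c g g₁ g₂ h k} {f : E H h k} {a : E G g g₁} {a′ : E G g₁ g₂} {s t} →
               s ≈[ c ] t → moveG f a a′ s ≈[ c ] moveG f a a′ t
  moveG-cong p = push-cong refl (push-cong refl p)

  moveH-cong : ∀ {c h h₁ h₂ g l} {e : E G g l} {b : E H h h₁} {b′ : E H h₁ h₂} {s t} →
               s ≈[ c ] t → moveH e b b′ s ≈[ c ] moveH e b b′ t
  moveH-cong p = push-cong refl (push-cong refl p)

  -- For each two steps of `A`, the two auxiliary edges give the two halves of a 4-cycle, which
  -- `via` identifies.
  liftG-indep : ∀ {g g′ h k l} (f : E H h k) (f′ : E H h l) (A : Wk (raw G) false g g′) s →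
                act (liftG f A) s ≈[ 0ℤ ] act (liftG f′ A) s
  liftG-indep f f′ nil                 s = ≈-refl
  liftG-indep f f′ (step a (step b A)) s =
    ≈-trans (liftG-indep f f′ A _) (act-cong (liftG f′ A) (via _ _ _ _ s))

  liftH-indep : ∀ {g k l h h′} (e : E G g k) (e′ : E G g l) (B : Wk (raw H) false h h′) s →
                act (liftH e B) s ≈[ 0ℤ ] act (liftH e′ B) s
  liftH-indep e e′ nil                 s = ≈-refl
  liftH-indep e e′ (step a (step b B)) s =
    ≈-trans (liftH-indep e e′ B _) (act-cong (liftH e′ B) (via _ _ _ _ s))

  -- `via` reroutes both moves through `(g₁ , h₁)`; the path then runs from there to `(g₂ , h)` and
  -- straight back, which `push-push` cancels.
  diagonalGH : ∀ {g g₁ g₂ h h₁ h₂ k l} (a : E G g g₁) (a′ : E G g₁ g₂) (b : E H h h₁) (b′ : E H h₁ h₂)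
               (f : E H h k) (e : E G g₂ l) s →
               moveH e b b′ (moveG f a a′ s) ≈[ 0ℤ ] pushX (a′ , b′) (pushX (a , b) s)
  diagonalGH a a′ b b′ f e s =
    ≈-trans (moveH-cong {e = e} {b} {b′} (via _ _ _ _ s))
      (≈-trans (via _ _ (symm G a′ , b) (a′ , b′) (moveG b a a′ s)) (push-cong refl (push-push refl)))

  diagonalHG : ∀ {g g₁ g₂ h h₁ h₂ k l} (a : E G g g₁) (a′ : E G g₁ g₂) (b : E H h h₁) (b′ : E H h₁ h₂)
               (f : E H h₂ k) (e : E G g l) s →
               moveG f a a′ (moveH e b b′ s) ≈[ 0ℤ ] pushX (a′ , b′) (pushX (a , b) s)
  diagonalHG a a′ b b′ f e s =
    ≈-trans (moveG-cong {f = f} {a} {a′} (via _ _ _ _ s))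
      (≈-trans (via _ _ (a , symm H b′) (a′ , b′) (moveH a b b′ s)) (push-cong refl (push-push refl)))

  -- Both orders of a two-step move in G and one in H equal the same diagonal, so `B` can be passed
  -- two steps at a time.
  commute-move : ∀ {g g₁ g₂ h h′ k k′ l l′} (a : E G g g₁) (a′ : E G g₁ g₂) (B : Wk (raw H) false h h′)
                 (f : E H h k) (f′ : E H h′ k′) (e : E G g l) (e′ : E G g₂ l′) s →
                 act (liftH e′ B) (moveG f a a′ s) ≈[ 0ℤ ] moveG f′ a a′ (act (liftH e B) s)
  commute-move a a′ nil f f′ e e′ s = via _ _ _ _ s
  commute-move a a′ (step b (step b′ B)) f f′ e e′ s =
    ≈-trans (act-cong (liftH e′ B) (≈-trans (diagonalGH a a′ b b′ f e′ s)
                                            (≈-sym₀ (diagonalHG a a′ b b′ (symm H b′) e s))))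
            (commute-move a a′ B (symm H b′) f′ e e′ _)

  commute : ∀ {g g′ h h′ k k′ l l′} (A : Wk (raw G) false g g′) (B : Wk (raw H) false h h′)
            (f : E H h k) (f′ : E H h′ k′) (e : E G g l) (e′ : E G g′ l′) s →
            act (liftH e′ B) (act (liftG f A) s) ≈[ 0ℤ ] act (liftG f′ A) (act (liftH e B) s)
  commute nil B f f′ e e′ s = liftH-indep e′ e B s
  commute (step a (step a′ A)) B f f′ e e′ s =
    ≈-trans (commute A B f f′ (symm G a′) e′ _)
            (act-cong (liftG f′ A) (commute-move a a′ B f f′ e (symm G a′) s))

  -- The first two steps of `w` form a diagonal, hence a move in G followed by one in H; the latter
  -- is then commuted past the G-part of the rest.
  split : ∀ {x y k l} (w : Wk X false x y) (f : E H (proj₂ x) k) (e : E G (proj₁ y) l) s →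
          act w s ≈[ 0ℤ ] act (liftH e (projH w)) (act (liftG f (projG w)) s)
  split nil f e s = ≈-refl
  split (step (a , b) (step (a′ , b′) w)) f e s =
    ≈-trans (split w (symm H b′) e _)
      (act-cong (liftH e (projH w)) (≈-trans
        (act-cong (liftG (symm H b′) (projG w)) (≈-sym₀ (diagonalGH a a′ b b′ f (symm G a′) s)))
        (≈-sym₀ (commute (projG w) (step b (step b′ nil)) f (symm H b′) (symm G a′) e (moveG f a a′ s)))))

  liftG-++ : ∀ {g g′ g″ h k} (f : E H h k) (A : Wk (raw G) false g g′) (B : Wk (raw G) false g′ g″) s →
             act (liftG f (A ++ B)) s ≈[ 0ℤ ] act (liftG f B) (act (liftG f A) s)
  liftG-++ f nil B s = ≈-refl
  liftG-++ f (step a (step b A)) B s = liftG-++ f A B _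

  liftH-++ : ∀ {h h′ h″ g k} (e : E G g k) (A : Wk (raw H) false h h′) (B : Wk (raw H) false h′ h″) s →
             act (liftH e (A ++ B)) s ≈[ 0ℤ ] act (liftH e B) (act (liftH e A) s)
  liftH-++ e nil B s = ≈-refl
  liftH-++ e (step a (step b A)) B s = liftH-++ e A B _

-- Winding colourings and columns

module Fields (G H K : Graph) (sf : SquareFree K) (μ : Hom (raw G ⊗ raw H) (raw K)) where
  open Squares G H K sf μ public

  listedX : Listed (V X)
  listedX = listedVertices G ×-listed listedVertices H

  _≐_ : ∀ {a b} → End a → End b → Set
  s ≐ t = ∀ i → seq s i ≡ seq t i

  -- A globally invariant end: μ winds around a single cycle, up to tails.
  record Winding : Set where
    field
      end      : ∀ x → End (fun μ x)
      coherent : ∀ {x y} (e : Adj X x y) → pushX e (end x) ≐ end y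
      period   : ℕ
      positive : 1 ≤ period
      bound    : ℕ
      periodic : ∀ x → Periodic bound period (end x)

  -- Unlike in a winding, the heights are coherent too, so they can be compared within the column.
  record Column (g : Vx G) : Set where
    field
      end      : ∀ h → End (fun μ (g , h))
      coherent : ∀ {g′ h₁ h′ h₂} (e : E G g g′) (e₁ : E H h₁ h′) (e₂ : E H h₂ h′) →
                 pushX (e , e₁) (end h₁) ≈[ 0ℤ ] pushX (e , e₂) (end h₂)

  module Classify (walkH : ∀ u v → Wk (raw H) false u v) (walkX : ∀ b x y → Wk X b x y)
    (g₀ : Vx G) (h₀ : Vx H) (s₀ : End (fun μ (g₀ , h₀)))
    (σ : Wk X true (g₀ , h₀) (g₀ , h₀)) {c : ℤ} (σ-fix : act σ s₀ ≈[ c ] s₀)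
    (A : Wk (raw G) false g₀ g₀) {a : ℤ} (a≢0 : a ≢ 0ℤ) (A-fix : act (liftG (nbH h₀) A) s₀ ≈[ a ] s₀) where

    hatG : Wk (raw G) false g₀ g₀ → Wk X false (g₀ , h₀) (g₀ , h₀)
    hatG = liftG (nbH h₀)

    hatH : ∀ {h} → Wk (raw H) false h₀ h → Wk X false (g₀ , h₀) (g₀ , h)
    hatH = liftH (nbG g₀)

    commutes : ∀ C D s → act (hatH D) (act (hatG C) s) ≈[ 0ℤ ] act (hatG C) (act (hatH D) s)
    commutes C D = commute C D (nbH h₀) (nbH h₀) (nbG g₀) (nbG g₀)

    -- Since the two actions commute, `A` translates the image of `s₀` by the same `a`, and
    -- `fixed-unique` allows only one such end.
    closedH-fix : ∀ D → act (hatH D) s₀ ≐ s₀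
    closedH-fix D i = sym (fixed-unique (hatG A) s₀ (act (hatH D) s₀) a≢0 A-fix
      (≈-transˡ (≈-sym₀ (commutes A D s₀)) (act-cong (hatH D) A-fix)) i)

    end : ∀ x → End (fun μ x)
    end x = act (walkX false (g₀ , h₀) x) s₀

    periodicity : ∃₂ λ d p → 1 ≤ p × Periodic d p s₀
    periodicity = fixed-periodic (hatG A) s₀ a≢0 A-fix

    p : ℕ
    p = proj₁ (proj₂ periodicity)

    1≤p : 1 ≤ p
    1≤p = proj₁ (proj₂ (proj₂ periodicity))

    end-periodic : ∀ x → ∃ λ d → Periodic d p (end x)
    end-periodic x = act-periodic (walkX false (g₀ , h₀) x) s₀ (proj₂ (proj₂ (proj₂ periodicity)))

    -- The obstruction to a winding with these ends. It is decidable because all ends involved are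
    -- eventually periodic with the common period `p`.
    BadEdge : V X → V X → Set
    BadEdge x y = Σ (Adj X x y) λ e → ¬ (pushX e (end x) ≐ end y)

    badEdge? : ∀ x y → Dec (BadEdge x y)
    badEdge? x y with adj? G (proj₁ x) (proj₁ y) ×-dec adj? H (proj₂ x) (proj₂ y)
    ... | no ¬e = no λ (e , _) → ¬e e
    ... | yes e with pts? {s = pushX e (end x)} {end y} 1≤p
                       (push-periodic (pres μ e) (end x) (proj₂ (end-periodic x))) (proj₂ (end-periodic y))
    ...   | no ¬eq = yes (e , ¬eq)
    -- An edge may have several proofs of adjacency; the verdict found for `e` is carried over to
    -- `e′`.
    ...   | yes eq = no λ (e′ , ¬eq) → ¬eq λ i →
      trans (pts (push-cong {e = pres μ e′} {e′ = pres μ e} {s = end x} refl ≈-refl) i) (eq i)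

    winding : ¬ ∃₂ BadEdge → Winding
    winding ¬bad = record
      { end = end ; coherent = coherent ; period = p ; positive = 1≤p ; bound = proj₁ bounds
      ; periodic = λ x → periodic-weaken {s = end x} (proj₂ bounds x) (proj₂ (end-periodic x)) }
      where
      bounds : ∃ λ m → ∀ x → proj₁ (end-periodic x) ≤ m
      bounds = bounded-listed listedX (proj₁ ∘ end-periodic)
      coherent : ∀ {x y} (e : Adj X x y) → pushX e (end x) ≐ end y
      coherent {x} {y} e i with seq (pushX e (end x)) i ≟ seq (end y) i
      ... | yes eq = eq
      ... | no neq = contradiction (x , y , e , λ eq → neq (eq i)) ¬bad

    -- A closed H-walk that translates along s₀ forces every even closed walk to fix s₀.
    module Translating (D : Wk (raw H) false h₀ h₀) {b : ℤ} (b≢0 : b ≢ 0ℤ) (D-fix : act (hatH D) s₀ ≈[ b ] s₀) where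

      even-fix : ∀ w → ∃ λ c → act w s₀ ≈[ c ] s₀
      even-fix w = _ , ≈-trans (split w (nbH h₀) (nbG g₀) s₀)
        (≈-trans (act-cong (hatH (projH w)) (pts⇒≈ C-fix)) (pts⇒≈ (closedH-fix (projH w))))
        where
        C : Wk (raw G) false g₀ g₀
        C = projG w
        C-fix : act (hatG C) s₀ ≐ s₀
        C-fix i = sym (fixed-unique (hatH D) s₀ (act (hatG C) s₀) b≢0 D-fix
          (≈-transˡ (commutes C D s₀) (act-cong (hatG C) D-fix)) i)

      -- Two even closed walks ending with the same odd walk `U` are compared: one goes to `x` and
      -- crosses `e`, the other runs through `σ` for parity and then goes to `y`. Both fix `s₀` up
      -- to height, `σ` does so by itself, and `U` acts injectively.
      good : ∀ {x y} (e : Adj X x y) → pushX e (end x) ≐ end y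
      good {x} {y} e = pts (act-injective U
        (≈-trans (≈-trans (≈-sym₀ (act-++ (walkX false _ x) (step e U) s₀)) (proj₂ (even-fix (walkX false _ x ++ step e U))))
          (≈-trans (≈-sym (proj₂ (even-fix (σ ++ W ++ U))))
            (≈-trans (act-++ σ (W ++ U) s₀) (≈-trans (act-++ W U (act σ s₀)) (act-cong U (act-cong W σ-fix)))))))
        where
        U : Wk X true y (g₀ , h₀)
        U = walkX true y (g₀ , h₀)
        W : Wk X false (g₀ , h₀) y
        W = walkX false (g₀ , h₀) y

    -- A bad edge excludes `Translating`, so every even closed walk of H moves `s₀` by exactly 0,
    -- and transport within the column respects heights as well.
    column : ∃₂ BadEdge → Column g₀
    column (_ , _ , e , bad) = record { end = endH ; coherent = coherent }
      where
      closed : ∀ D → act (hatH D) s₀ ≈[ 0ℤ ] s₀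
      closed D with (ht (act (hatH D) s₀) ℤ.- ht s₀) ℤₚ.≟ 0ℤ
      ... | yes eq = subst (λ b → act (hatH D) s₀ ≈[ b ] s₀) eq (pts⇒≈ (closedH-fix D))
      ... | no neq = contradiction (Translating.good D neq (pts⇒≈ (closedH-fix D)) e) bad

      endH : ∀ h → End (fun μ (g₀ , h))
      endH h = act (hatH (walkH h₀ h)) s₀

      endH-step : ∀ {h₁ h₂} (w : Wk (raw H) false h₁ h₂) → act (liftH (nbG g₀) w) (endH h₁) ≈[ 0ℤ ] endH h₂
      endH-step {h₁} {h₂} w = act-injective (liftH (nbG g₀) U)
        (≈-trans (act-cong (liftH (nbG g₀) U) (≈-sym₀ (liftH-++ (nbG g₀) (walkH h₀ h₁) w s₀)))
          (≈-trans (≈-sym₀ (liftH-++ (nbG g₀) (walkH h₀ h₁ ++ w) U s₀))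
            (≈-trans (closed ((walkH h₀ h₁ ++ w) ++ U))
              (≈-trans (≈-sym₀ (closed (walkH h₀ h₂ ++ U))) (liftH-++ (nbG g₀) (walkH h₀ h₂) U s₀)))))
        where
        U : Wk (raw H) false h₂ h₀
        U = walkH h₂ h₀

      coherent : ∀ {g′ h₁ h′ h₂} (e : E G g₀ g′) (e₁ : E H h₁ h′) (e₂ : E H h₂ h′) →
                 pushX (e , e₁) (endH h₁) ≈[ 0ℤ ] pushX (e , e₂) (endH h₂)
      coherent {h₁ = h₁} e e₁ e₂ =
        ≈-trans (≈-sym₀ (push-push {e = pres μ (symm G e , symm H e₂)} {e′ = pres μ (e , e₂)} refl))
          (push-cong refl (≈-trans (liftH-indep e (nbG g₀) w (endH h₁)) (endH-step w)))
        where
        w : Wk (raw H) false _ _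
        w = step e₁ (step (symm H e₂) nil)

    classify : Column g₀ ⊎ Winding
    classify with any-listed? listedX (λ x → any-listed? listedX (badEdge? x))
    ... | yes bad = inj₁ (column bad)
    ... | no ¬bad = inj₂ (winding ¬bad)

-- Retracting a winding colouring onto a cycle

least : {P : ℕ → Set} → (∀ n → Dec (P n)) → ∀ {k} → P k → ∃ λ n → P n × ∀ m → m ℕ.< n → ¬ P m
least {P} P? {k} pk with below (suc k)
  where
  below : ∀ k → (∃ λ n → P n × ∀ m → m ℕ.< n → ¬ P m) ⊎ (∀ m → m ℕ.< k → ¬ P m)
  below zero = inj₂ λ _ ()
  below (suc k) with below k
  ... | inj₁ found = inj₁ found
  ... | inj₂ none with P? k
  ... | yes pk = inj₁ (k , pk , none)
  ... | no ¬pk = inj₂ λ m m<1+k pm → case m (ℕₚ.m≤n⇒m<n∨m≡n (ℕₚ.≤-pred m<1+k)) pm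
    where
    case : ∀ m → m ℕ.< k ⊎ m ≡ k → ¬ P m
    case m (inj₁ m<k) = none m m<k
    case m (inj₂ refl) = ¬pk
... | inj₁ found = found
... | inj₂ none  = contradiction pk (none k ℕₚ.≤-refl)

module Tracking (K : Graph) {X : RawGraph} (_≟X_ : DecidableEquality (V X)) (listedX : Listed (V X))
  (X-symm : ∀ {x y} → Adj X x y → Adj X y x) (x₀ : V X) (walkX : ∀ x → ∃ λ b → Wk X b x₀ x) where
  open Ends K

  TailOf : ∀ {a b} → End a → End b → Set
  TailOf s t = ∀ i → seq t i ≡ seq s (suc i)

  tailOf⇒adj : ∀ {a b} (s : End a) (t : End b) → TailOf s t → E K a b
  tailOf⇒adj s t q = subst₂ (E K) (origin s) (trans (sym (q 0)) (origin t)) (adj s 0)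

  drop : ∀ {a} n (s : End a) → End (seq s n)
  drop n s = record { seq = λ i → seq s (n ℕ.+ i) ; ht = ht s ; origin = cong (seq s) (ℕₚ.+-identityʳ n)
                    ; adj = λ i → subst (λ j → E K (seq s (n ℕ.+ i)) (seq s j)) (sym (ℕₚ.+-suc n i)) (adj s (n ℕ.+ i))
                    ; red = λ i eq → red s (n ℕ.+ i) (trans eq (cong (seq s)
                        (trans (ℕₚ.+-suc n (suc i)) (cong suc (ℕₚ.+-suc n i))))) }

  record Tracks (μ : Hom X (raw K)) (d p : ℕ) : Set where
    field
      end      : ∀ x → End (fun μ x)
      trail     : ∀ {x y} → Adj X x y → TailOf (end x) (end y) ⊎ TailOf (end y) (end x)
      periodic : ∀ x → Periodic d p (end x)

  -- The vertices whose end has the longest preperiod see only one colour around them,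
  -- hence can be moved two steps along their ends.
  module Descend {d p} {μ : Hom X (raw K)} (T : Tracks μ (suc d) p) where
    open Tracks T

    Far : V X → Set
    Far x = seq (end x) (p ℕ.+ d) ≢ seq (end x) d

    -- Passing to a tail shortens the preperiod by one. Hence every ray next to a far vertex is the
    -- tail of the far ray, and no two far vertices are adjacent.
    near-tail : ∀ {x y} → TailOf (end x) (end y) → ¬ Far y
    near-tail {x} {y} q far = far (trans (q (p ℕ.+ d)) (trans (cong (seq (end x)) (sym (ℕₚ.+-suc p d)))
      (trans (periodic x (suc d) ℕₚ.≤-refl) (sym (q d)))))

    far? : ∀ x → (seq (end x) (p ℕ.+ d) ≡ seq (end x) d) ⊎ Far x
    far? x with seq (end x) (p ℕ.+ d) ≟ seq (end x) d
    ... | yes eq = inj₁ eq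
    ... | no neq = inj₂ neq

    moved : ∀ x → (seq (end x) (p ℕ.+ d) ≡ seq (end x) d) ⊎ Far x → Σ (Vx K) End
    moved x (inj₁ _) = fun μ x , end x
    moved x (inj₂ _) = seq (end x) 2 , drop 2 (end x)

    moved-trail : ∀ {x y} c c′ → Adj X x y → TailOf (proj₂ (moved x c)) (proj₂ (moved y c′)) ⊎
                                            TailOf (proj₂ (moved y c′)) (proj₂ (moved x c))
    moved-trail (inj₁ _) (inj₁ _) e = trail e
    moved-trail (inj₂ far) c′ e with trail e
    moved-trail (inj₂ far) c′         e | inj₂ q = contradiction far (near-tail q)
    -- The trail changes direction: after dropping two points, the ray at `x` is the tail of the ray
    -- at `y`.
    moved-trail (inj₂ far) (inj₁ _)   e | inj₁ q = inj₂ λ i → sym (q (suc i))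
    moved-trail (inj₂ far) (inj₂ far′) e | inj₁ q = contradiction far′ (near-tail q)
    moved-trail (inj₁ _) (inj₂ far) e with trail e
    ... | inj₁ q = contradiction far (near-tail q)
    ... | inj₂ q = inj₁ λ i → sym (q (suc i))

    colour-adj : ∀ {x y} c c′ → Adj X x y → E K (proj₁ (moved x c)) (proj₁ (moved y c′))
    colour-adj {x} {y} c c′ e with moved-trail c c′ e
    ... | inj₁ q = tailOf⇒adj (proj₂ (moved x c)) (proj₂ (moved y c′)) q
    ... | inj₂ q = symm K (tailOf⇒adj (proj₂ (moved y c′)) (proj₂ (moved x c)) q)

    ν : Hom X (raw K)
    ν = hom (λ x → proj₁ (moved x (far? x))) (λ {x} {y} → colour-adj (far? x) (far? y))

    agree : ∀ {x y} → Adj X x y → fun μ x ≡ fun ν x ⊎ fun μ y ≡ fun ν y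
    agree {x} {y} e with far? x | far? y
    ... | inj₁ _   | _        = inj₁ refl
    ... | inj₂ _   | inj₁ _   = inj₂ refl
    ... | inj₂ far | inj₂ far′ with trail e
    ...   | inj₁ q = contradiction far′ (near-tail q)
    ...   | inj₂ q = contradiction far (near-tail q)

    reach : Reachable μ ν
    reach = Interpolate.reach _≟X_ listedX (symm K) μ ν agree x₀

    moved-periodic : ∀ x c → Periodic d p (proj₂ (moved x c))
    moved-periodic x (inj₁ eq) i d≤i with ℕₚ.m≤n⇒m<n∨m≡n d≤i
    ... | inj₁ d<i  = periodic x i d<i
    ... | inj₂ refl = eq
    moved-periodic x (inj₂ _) i d≤i =
      trans (cong (seq (end x)) (trans (cong suc (sym (ℕₚ.+-suc p i))) (sym (ℕₚ.+-suc p (suc i)))))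
        (periodic x (suc (suc i)) (s≤s (ℕₚ.m≤n⇒m≤1+n d≤i)))

    tracks : Tracks ν d p
    tracks = record { end = λ x → proj₂ (moved x (far? x)) ; trail = λ {x} {y} → moved-trail (far? x) (far? y)
                    ; periodic = λ x → moved-periodic x (far? x) }

  module Pure {p} (1≤p : 1 ≤ p) {μ : Hom X (raw K)} (T : Tracks μ 0 p) where
    open Tracks T

    s : End (fun μ x₀)
    s = end x₀

    IsPeriod : ℕ → Set
    IsPeriod n = 1 ≤ n × ∀ i → seq s (n ℕ.+ i) ≡ seq s i

    isPeriod? : ∀ n → Dec (IsPeriod n)
    isPeriod? n = (1 ℕ.≤? n) ×-dec pts? {s = drop n s} {s} 1≤p drop-periodic (periodic x₀)
      where
      drop-periodic : Periodic 0 p (drop n s)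
      drop-periodic i _ = trans (cong (seq s) index) (periodic x₀ (n ℕ.+ i) z≤n)
        where
        open ≡-Reasoning
        index : n ℕ.+ (p ℕ.+ i) ≡ p ℕ.+ (n ℕ.+ i)
        index = begin
          n ℕ.+ (p ℕ.+ i) ≡⟨ sym (ℕₚ.+-assoc n p i) ⟩
          n ℕ.+ p ℕ.+ i   ≡⟨ cong (ℕ._+ i) (ℕₚ.+-comm n p) ⟩
          p ℕ.+ n ℕ.+ i   ≡⟨ ℕₚ.+-assoc p n i ⟩
          p ℕ.+ (n ℕ.+ i) ∎

    minimal : ∃ λ n → IsPeriod n × ∀ m → m ℕ.< n → ¬ IsPeriod m
    minimal = least isPeriod? {p} (1≤p , λ i → periodic x₀ i z≤n)

    module Minimal (k : ℕ) (per : ∀ i → seq s (suc k ℕ.+ i) ≡ seq s i) (min : ∀ m → m ℕ.< suc k → ¬ IsPeriod m) where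
      n : ℕ
      n = suc k

      multiple : ∀ m i → seq s (m ℕ.* n ℕ.+ i) ≡ seq s i
      multiple zero    i = refl
      multiple (suc m) i = trans (cong (seq s) (ℕₚ.+-assoc n (m ℕ.* n) i)) (trans (per (m ℕ.* n ℕ.+ i)) (multiple m i))

      seq-% : ∀ m i → seq s (m % n ℕ.+ i) ≡ seq s (m ℕ.+ i)
      seq-% m i = sym (trans (cong (seq s) index) (multiple (m / n) (m % n ℕ.+ i)))
        where
        open ≡-Reasoning
        index : m ℕ.+ i ≡ m / n ℕ.* n ℕ.+ (m % n ℕ.+ i)
        index = begin
          m ℕ.+ i                            ≡⟨ cong (ℕ._+ i) (m≡m%n+[m/n]*n m n) ⟩
          m % n ℕ.+ m / n ℕ.* n ℕ.+ i        ≡⟨ cong (ℕ._+ i) (ℕₚ.+-comm (m % n) (m / n ℕ.* n)) ⟩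
          m / n ℕ.* n ℕ.+ m % n ℕ.+ i        ≡⟨ ℕₚ.+-assoc (m / n ℕ.* n) (m % n) i ⟩
          m / n ℕ.* n ℕ.+ (m % n ℕ.+ i)      ∎

      -- Shifting both sides by `n ∸ a` turns the coincidence into the period `b ∸ a`, which is
      -- smaller than the least one.
      no-shift : ∀ a b → a ℕ.< b → b ℕ.< n → ¬ (∀ i → seq s (a ℕ.+ i) ≡ seq s (b ℕ.+ i))
      no-shift a b a<b b<n eq = min (b ℕ.∸ a) (ℕₚ.≤-<-trans (ℕₚ.m∸n≤m b a) b<n) (ℕₚ.m<n⇒0<n∸m a<b , shift)
        where
        open ≡-Reasoning
        a≤n : a ≤ n
        a≤n = ℕₚ.<⇒≤ (ℕₚ.<-trans a<b b<n)
        index : ∀ i → b ℕ.+ (n ℕ.∸ a ℕ.+ i) ≡ n ℕ.+ (b ℕ.∸ a ℕ.+ i)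
        index i = begin
          b ℕ.+ (n ℕ.∸ a ℕ.+ i)                       ≡⟨ cong (ℕ._+ (n ℕ.∸ a ℕ.+ i)) (sym (ℕₚ.m∸n+n≡m (ℕₚ.<⇒≤ a<b))) ⟩
          b ℕ.∸ a ℕ.+ a ℕ.+ (n ℕ.∸ a ℕ.+ i)           ≡⟨ ℕₚ.+-assoc (b ℕ.∸ a) a _ ⟩
          b ℕ.∸ a ℕ.+ (a ℕ.+ (n ℕ.∸ a ℕ.+ i))         ≡⟨ cong (b ℕ.∸ a ℕ.+_) (sym (ℕₚ.+-assoc a (n ℕ.∸ a) i)) ⟩
          b ℕ.∸ a ℕ.+ (a ℕ.+ (n ℕ.∸ a) ℕ.+ i)         ≡⟨ cong (λ j → b ℕ.∸ a ℕ.+ (j ℕ.+ i)) (ℕₚ.m+[n∸m]≡n a≤n) ⟩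
          b ℕ.∸ a ℕ.+ (n ℕ.+ i)                       ≡⟨ sym (ℕₚ.+-assoc (b ℕ.∸ a) n i) ⟩
          b ℕ.∸ a ℕ.+ n ℕ.+ i                         ≡⟨ cong (ℕ._+ i) (ℕₚ.+-comm (b ℕ.∸ a) n) ⟩
          n ℕ.+ (b ℕ.∸ a) ℕ.+ i                       ≡⟨ ℕₚ.+-assoc n (b ℕ.∸ a) i ⟩
          n ℕ.+ (b ℕ.∸ a ℕ.+ i)                       ∎
        shift : ∀ i → seq s (b ℕ.∸ a ℕ.+ i) ≡ seq s i
        shift i = begin
          seq s (b ℕ.∸ a ℕ.+ i)           ≡⟨ sym (per (b ℕ.∸ a ℕ.+ i)) ⟩
          seq s (n ℕ.+ (b ℕ.∸ a ℕ.+ i))   ≡⟨ cong (seq s) (sym (index i)) ⟩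
          seq s (b ℕ.+ (n ℕ.∸ a ℕ.+ i))   ≡⟨ sym (eq (n ℕ.∸ a ℕ.+ i)) ⟩
          seq s (a ℕ.+ (n ℕ.∸ a ℕ.+ i))   ≡⟨ cong (seq s) (sym (ℕₚ.+-assoc a (n ℕ.∸ a) i)) ⟩
          seq s (a ℕ.+ (n ℕ.∸ a) ℕ.+ i)   ≡⟨ cong (λ j → seq s (j ℕ.+ i)) (ℕₚ.m+[n∸m]≡n a≤n) ⟩
          seq s (n ℕ.+ i)                 ≡⟨ per i ⟩
          seq s i                         ∎

      position-unique : ∀ a b → (∀ i → seq s (a ℕ.+ i) ≡ seq s (b ℕ.+ i)) → a % n ≡ b % n
      position-unique a b eq with ℕₚ.<-cmp (a % n) (b % n)
      ... | tri≈ _ a≡b _ = a≡b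
      ... | tri< a<b _ _ = contradiction (λ i → trans (seq-% a i) (trans (eq i) (sym (seq-% b i))))
                             (no-shift (a % n) (b % n) a<b (m%n<n b n))
      ... | tri> _ _ b<a = contradiction (λ i → trans (seq-% b i) (trans (sym (eq i)) (sym (seq-% a i))))
                             (no-shift (b % n) (a % n) b<a (m%n<n a n))

      locate : ∀ {b x y} → Wk X b x y → ∀ k → (∀ i → seq (end x) i ≡ seq s (k ℕ.+ i)) →
               ∃ λ m → ∀ i → seq (end y) i ≡ seq s (m ℕ.+ i)
      locate nil k on = k , on
      locate (step {y = y} e w) k on with trail e
      ... | inj₁ q = locate w (suc k) λ i → trans (q i) (trans (on (suc i)) (cong (seq s) (ℕₚ.+-suc k i)))
      -- One place back along a `p`-periodic ray is `p - 1` places forward, so positions stay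
      -- natural numbers.
      ... | inj₂ q = locate w (k ℕ.+ ℕ.pred p) λ i →
        trans (trans (sym (periodic y i z≤n)) (cong (λ j → seq (end y) (j ℕ.+ i)) (sym (ℕₚ.suc-pred p {{ℕ.>-nonZero 1≤p}}))))
          (trans (sym (q (ℕ.pred p ℕ.+ i))) (trans (on (ℕ.pred p ℕ.+ i)) (cong (seq s) (sym (ℕₚ.+-assoc k (ℕ.pred p) i)))))

      located : ∀ x → ∃ λ m → ∀ i → seq (end x) i ≡ seq s (m ℕ.+ i)
      located x = locate (proj₂ (walkX x)) 0 (λ _ → refl)

      position : V X → Fin n
      position x = fromℕ< (m%n<n (proj₁ (located x)) n)

      toℕ-position : ∀ x → toℕ (position x) ≡ proj₁ (located x) % n
      toℕ-position x = Finₚ.toℕ-fromℕ< (m%n<n (proj₁ (located x)) n)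

      end-position : ∀ x i → seq (end x) i ≡ seq s (toℕ (position x) ℕ.+ i)
      end-position x i = trans (proj₂ (located x) i)
        (trans (sym (seq-% (proj₁ (located x)) i)) (cong (λ j → seq s (j ℕ.+ i)) (sym (toℕ-position x))))

      position-suc : ∀ {x y} → TailOf (end x) (end y) → toℕ (position y) ≡ suc (toℕ (position x)) % n
      position-suc {x} {y} q = trans (sym (m<n⇒m%n≡m (Finₚ.toℕ<n (position y))))
        (position-unique (toℕ (position y)) (suc (toℕ (position x))) λ i →
          trans (sym (end-position y i)) (trans (q i) (trans (end-position x (suc i)) (cong (seq s) (ℕₚ.+-suc _ i)))))

      γ-pres : ∀ {x y} → Adj X x y → CAdj n (position x) (position y)
      γ-pres {x} {y} e = distinct , consecutive
        where
        distinct : position x ≢ position y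
        -- Equal positions would give both ends of an edge the same colour.
        distinct eq = loopless K (fun μ y) (subst (λ v → E K v (fun μ y))
          (trans (sym (origin (end x))) (trans (end-position x 0)
            (trans (cong (λ j → seq s (toℕ j ℕ.+ 0)) eq) (trans (sym (end-position y 0)) (origin (end y)))))) (pres μ e))
        consecutive : toℕ (position y) ≡ suc (toℕ (position x)) % n ⊎ toℕ (position x) ≡ suc (toℕ (position y)) % n
        consecutive with trail e
        ... | inj₁ q = inj₁ (position-suc q)
        ... | inj₂ q = inj₂ (position-suc q)

      around : ∀ i j → j ≡ suc i % n → E K (seq s i) (seq s j)
      around i j refl = subst (E K (seq s i))
        (trans (cong (seq s) (sym (ℕₚ.+-identityʳ (suc i)))) (trans (sym (seq-% (suc i) 0))
          (cong (seq s) (ℕₚ.+-identityʳ (suc i % n))))) (adj s i)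

      δ-pres : ∀ {i j} → CAdj n i j → E K (seq s (toℕ i)) (seq s (toℕ j))
      δ-pres {i} {j} (_ , inj₁ eq) = around (toℕ i) (toℕ j) eq
      δ-pres {i} {j} (_ , inj₂ eq) = symm K (around (toℕ j) (toℕ i) eq)

      factors : FactorsThrough μ (Cyc n)
      factors = hom position γ-pres , hom (λ i → seq s (toℕ i)) (λ {i} {j} → δ-pres {i} {j}) , λ x →
        trans (sym (origin (end x))) (trans (end-position x 0) (cong (seq s) (ℕₚ.+-identityʳ _)))

    factors : ∃ λ n → FactorsThrough μ (Cyc n)
    factors with minimal
    ... | zero  , (() , _) , _
    ... | suc k , (_ , per) , min = suc k , Minimal.factors k per min

  settle : ∀ d {p} → 1 ≤ p → {μ : Hom X (raw K)} → Tracks μ d p →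
           Σ (Hom X (raw K)) λ μ* → Reachable μ μ* × ∃ λ n → FactorsThrough μ* (Cyc n)
  settle zero    1≤p {μ} T = μ , start , Pure.factors 1≤p T
  settle (suc d) 1≤p T =
    let (μ* , r , f) = settle d 1≤p (Descend.tracks T) in μ* , reachable-trans (Descend.reach T) r , f

-- Flattening the columns

maximum-listed : ∀ {A : Set} → Listed A → A → (f : A → ℤ) → ∃ λ a → ∀ b → f b ℤ.≤ f a
maximum-listed {A} L a₀ f = let (a , _ , m) = go (Listed.elems L) in a , λ b → m (Listed.complete L b)
  where
  go : (xs : List A) → ∃ λ a → f a₀ ℤ.≤ f a × ∀ {b} → b ∈ xs → f b ℤ.≤ f a
  go []       = a₀ , ℤₚ.≤-refl , λ ()
  go (x ∷ xs) with go xs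
  ... | a , m₀ , m with ℤₚ.≤-total (f a) (f x)
  ... | inj₁ a≤x = x , ℤₚ.≤-trans m₀ a≤x , λ { (here refl) → ℤₚ.≤-refl ; (there b∈) → ℤₚ.≤-trans (m b∈) a≤x }
  ... | inj₂ x≤a = a , m₀ , λ { (here refl) → x≤a ; (there b∈) → m b∈ }

count : ∀ {A : Set} {P : A → Set} → (∀ a → Dec (P a)) → List A → ℕ
count P? []       = 0
count P? (x ∷ xs) with P? x
... | yes _ = suc (count P? xs)
... | no  _ = count P? xs

module _ {A : Set} {P Q : A → Set} (P? : ∀ a → Dec (P a)) (Q? : ∀ a → Dec (Q a)) (P⇒Q : ∀ a → P a → Q a) where

  count-mono : ∀ xs → count P? xs ≤ count Q? xs
  count-mono []       = z≤n
  count-mono (x ∷ xs) with P? x | Q? x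
  ... | yes _ | yes _ = s≤s (count-mono xs)
  ... | yes p | no ¬q = contradiction (P⇒Q x p) ¬q
  ... | no _  | yes _ = ℕₚ.m≤n⇒m≤1+n (count-mono xs)
  ... | no _  | no _  = count-mono xs

  count-strict : ∀ {a} xs → a ∈ xs → Q a → ¬ P a → count P? xs ℕ.< count Q? xs
  count-strict (x ∷ xs) (here refl) q ¬p with P? x | Q? x
  ... | yes p | _     = contradiction p ¬p
  ... | no _  | yes _ = s≤s (count-mono xs)
  ... | no _  | no ¬q = contradiction q ¬q
  count-strict (x ∷ xs) (there a∈) q ¬p with P? x | Q? x
  ... | yes _ | yes _ = s≤s (count-strict xs a∈ q ¬p)
  ... | yes p | no ¬q = contradiction (P⇒Q x p) ¬q
  ... | no _  | yes _ = ℕₚ.m≤n⇒m≤1+n (count-strict xs a∈ q ¬p)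
  ... | no _  | no _  = count-strict xs a∈ q ¬p

Steps : (H : Graph) → ℕ → Vx H → Vx H → Set
Steps H zero    u w = u ≡ w
Steps H (suc n) u w = ∃ λ v → Steps H n u v × E H v w

dbl : ℕ → ℕ
dbl zero    = zero
dbl (suc n) = suc (suc (dbl n))

-- Walks are padded by stepping to a neighbour and back, so the longest of finitely many even walks
-- sets a length that suits all pairs. This length will bound how far the columns can be climbed.
uniformSteps : (H : Graph) → (∀ u v → Wk (raw H) false u v) → ∃ λ n → ∀ u v → Steps H n u v
uniformSteps H walkH = dbl m , λ u v →
  let (k , st) = steps u v
  in subst (λ j → Steps H (dbl j) u v) (ℕₚ.m∸n+n≡m (bound (u , v))) (pad (m ℕ.∸ k) st)
  where
  count-steps : ∀ {u v w} k → Steps H (dbl k) u v → Wk (raw H) false v w → ∃ λ k → Steps H (dbl k) u w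
  count-steps k st nil                 = k , st
  count-steps k st (step a (step b w)) = count-steps (suc k) (_ , (_ , st , a) , b) w
  steps : ∀ u v → ∃ λ k → Steps H (dbl k) u v
  steps u v = count-steps 0 refl (walkH u v)
  pad : ∀ {u v k} j → Steps H (dbl k) u v → Steps H (dbl (j ℕ.+ k)) u v
  pad zero    st = st
  pad {v = v} (suc j) st = let (w , e) = noIsolated H v in w , (v , pad j st , e) , symm H e
  bounds : ∃ λ m → ∀ uv → proj₁ (steps (proj₁ uv) (proj₂ uv)) ≤ m
  bounds = bounded-listed (listedVertices H ×-listed listedVertices H) (λ (u , v) → proj₁ (steps u v))
  m = proj₁ bounds
  bound = proj₂ bounds

-- Peaks of columns and ascents between columns

module Peaks (G H K : Graph) (sf : SquareFree K) (walkH : ∀ u v → Wk (raw H) false u v)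
  (μ : Hom (raw G ⊗ raw H) (raw K)) where
  open Fields G H K sf μ public
  open Column using (coherent)

  col : Vx G → Vx H → Vx K
  col g h = fun μ (g , h)

  constant-by-steps : ∀ {A : Set} (f : Vx H → A) → (∀ {h₁ h h₂} → E H h₁ h → E H h₂ h → f h₁ ≡ f h₂) → ∀ u v → f u ≡ f v
  constant-by-steps f eq u v = go (walkH u v)
    where
    go : ∀ {u} → Wk (raw H) false u v → f u ≡ f v
    go nil                 = refl
    go (step a (step b w)) = trans (eq a (symm H b)) (go w)

  -- Each new end is pushed from an arbitrarily chosen neighbour; coherence of `C` makes the choice
  -- immaterial. For the new coherence, both ends are taken to come from the common neighbour `h`,
  -- and the two paths then bound a 4-cycle.
  transport : ∀ {g g′} → E G g g′ → Column g → Column g′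
  transport {g} {g′} e C = record { end = end′ ; coherent = coherent′ }
    where
    end′ : ∀ h → End (col g′ h)
    end′ h = pushX (e , symm H (nbH h)) (Column.end C (proj₁ (noIsolated H h)))
    coherent′ : ∀ {g″ h₁ h h₂} (e′ : E G g′ g″) (e₁ : E H h₁ h) (e₂ : E H h₂ h) →
                pushX (e′ , e₁) (end′ h₁) ≈[ 0ℤ ] pushX (e′ , e₂) (end′ h₂)
    coherent′ {h₁ = h₁} {h} {h₂} e′ e₁ e₂ =
      ≈-trans (push-cong refl (coherent C e (symm H (nbH h₁)) (symm H e₁)))
        (≈-trans (via (e , symm H e₁) (e′ , e₁) (e , symm H e₂) (e′ , e₂) (Column.end C h))
          (push-cong refl (coherent C e (symm H e₂) (symm H (nbH h₂)))))

  carry : ∀ {b g g′} → Wk (raw G) b g g′ → Column g → Column g′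
  carry nil        C = C
  carry (step e w) C = carry w (transport e C)

  same-end : ∀ {g} (C : Column g) {h₁ h h₂} → E H h₁ h → E H h₂ h → col g h₁ ≡ col g h₂ →
             Column.end C h₁ ≈[ 0ℤ ] Column.end C h₂
  same-end {g} C e₁ e₂ eq = push-injective eq refl (coherent C (nbG g) e₁ e₂)

  record Peak (g : Vx G) : Set where
    field
      column : Column g
      top    : ℤ
      below  : ∀ h → ht (Column.end column h) ℤ.≤ top
      apex   : Vx H
      apex-top : ht (Column.end column apex) ≡ top
    open Column column public
  open Peak

  peak : ∀ {g} → Column g → Peak g
  peak C = let (h , max) = maximum-listed (listedVertices H) (someVertex H) (ht ∘ Column.end C)
           in record { column = C ; top = _ ; below = max ; apex = h ; apex-top = refl }

  AtTop : ∀ {g} → Peak g → Vx H → Set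
  AtTop P h = ht (end P h) ≡ top P

  -- The last condition makes the push extend the ray, so the height in the next column exceeds
  -- `top P`.
  Ascending : ∀ {g} → Peak g → Vx H → Vx G × Vx H → Set
  Ascending {g} P h (g′ , h′) = AtTop P h × (E G g g′ × E H h h′) × col g′ h′ ≢ seq (end P h) 1

  Isolated : ∀ {g} → Peak g → Set
  Isolated {g} P = ∀ {h g′ h′} → AtTop P h → E G g g′ → E H h h′ → col g′ h′ ≡ seq (end P h) 1

  ascending? : ∀ {g} (P : Peak g) → (∃₂ (Ascending P)) ⊎ Isolated P
  ascending? {g} P with any-listed? (listedVertices H) (λ h → any-listed? listedX (λ (g′ , h′) →
       (ht (end P h) ℤₚ.≟ top P) ×-dec ((adj? G g g′ ×-dec adj? H h h′) ×-dec ¬? (col g′ h′ ≟ seq (end P h) 1))))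
  ... | yes asc = inj₁ asc
  ... | no ¬asc = inj₂ isolated
    where
    isolated : Isolated P
    isolated {h} {g′} {h′} t e f with col g′ h′ ≟ seq (end P h) 1
    ... | yes eq = eq
    ... | no neq = contradiction (h , (g′ , h′) , t , (e , f) , neq) ¬asc

  push-≤ : ∀ {a k} (e : E K a k) (s : End a) {z} → ht s ℤ.≤ z → ht (push e s) ℤ.≤ 1ℤ ℤ.+ z
  push-≤ e s {z} h≤ with push e s | view e s
  ... | t | forth _ _ h = subst (ℤ._≤ 1ℤ ℤ.+ z) (sym h) (ℤₚ.+-monoʳ-≤ 1ℤ h≤)
  ... | t | back _ _ h  = subst (ℤ._≤ 1ℤ ℤ.+ z) (sym h) (ℤₚ.+-mono-≤ ℤ.-≤+ h≤)

  push-top : ∀ {a k} (e : E K a k) (s : End a) {z} → ht s ℤ.≤ z → ht (push e s) ≡ 1ℤ ℤ.+ z →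
             ht s ≡ z × ∀ i → seq (push e s) (suc i) ≡ seq s i
  push-top e s {z} h≤ eq with push e s | view e s
  ... | t | forth _ ps h = cancel (ht s) z (trans (sym h) eq) , ps
    where
    cancel : ∀ x y → 1ℤ ℤ.+ x ≡ 1ℤ ℤ.+ y → x ≡ y
    cancel x y eq = trans (lem x) (trans (cong (λ z → -1ℤ ℤ.+ z) eq) (sym (lem y)))
      where
      lem : ∀ x → x ≡ -1ℤ ℤ.+ (1ℤ ℤ.+ x)
      lem = solve-∀
  ... | t | back _ _ h = contradiction (ℤₚ.≤-trans (ℤₚ.≤-reflexive (sym eq)) (ℤₚ.≤-trans (ℤₚ.≤-reflexive h) (ℤₚ.+-monoʳ-≤ -1ℤ h≤)))
                           (ℤₚ.<⇒≱ (ℤₚ.+-monoˡ-< z {x = -1ℤ} {y = 1ℤ} ℤ.-<+))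

  transport-end : ∀ {g g′} (e : E G g g′) (C : Column g) {h h′} (f : E H h h′) →
                  Column.end (transport e C) h′ ≈[ 0ℤ ] pushX (e , f) (Column.end C h)
  transport-end e C {h′ = h′} f = coherent C e (symm H (nbH h′)) f

  module Ascend {g} (P : Peak g) {h g₁ h₁} (t : AtTop P h) (e : E G g g₁) (f : E H h h₁)
    (new : col g₁ h₁ ≢ seq (end P h) 1) where

    ascended : Peak g₁
    ascended = record
      { column = transport e (column P) ; top = 1ℤ ℤ.+ top P ; apex = h₁
      ; below = λ h′ → push-≤ _ (end P _) (below P _)
      ; apex-top = trans (≈-hts (transport-end e (column P) f)) risen }
      where
      risen : ht (pushX (e , f) (end P h)) ≡ 1ℤ ℤ.+ top P
      risen with pushX (e , f) (end P h) | view (pres μ (e , f)) (end P h)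
      ... | _ | back eq _ _  = contradiction eq new
      ... | _ | forth _ _ h≡ = trans h≡ (cong (λ z → 1ℤ ℤ.+ z) t)

    -- Only extending the ray of an old top vertex reaches the new top, and the ray so obtained has
    -- the old colour as its second point.
    descend : ∀ {h h′} → AtTop ascended h′ → E H h h′ → AtTop P h × col g h ≡ seq (end ascended h′) 1
    descend {h} {h′} t′ f′ =
      let p          = transport-end e (column P) f′
          (ht≡ , ps) = push-top (pres μ (e , f′)) (end P h) (below P h) (trans (sym (≈-hts p)) t′)
      in ht≡ , sym (trans (pts p 1) (trans (ps 0) (origin (end P h))))

    allTop⇒constant : (∀ h → AtTop ascended h) → ∀ u v → col g u ≡ col g v
    allTop⇒constant all = constant-by-steps (col g) λ e₁ e₂ →
      trans (proj₂ (descend (all _) e₁)) (sym (proj₂ (descend (all _) e₂)))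

  NonConstant : Vx G → Set
  NonConstant g = ∃₂ λ u v → col g u ≢ col g v

  nonConstant? : ∀ g → Dec (NonConstant g)
  nonConstant? g = any-listed? (listedVertices H) λ u → any-listed? (listedVertices H) λ v → ¬? (col g u ≟ col g v)

  Found : Set
  Found = Σ (Vx G) λ g → Σ (Peak g) λ P → NonConstant g × Isolated P

  constant⇒allTop : ∀ {g} (P : Peak g) → ¬ NonConstant g → ∀ h → AtTop P h
  constant⇒allTop {g} P const h = trans (constant-by-steps (ht ∘ end P) (λ e₁ e₂ → ≈-hts (same-end (column P) e₁ e₂ (equal _ _))) h (apex P))
    (apex-top P)
    where
    equal : ∀ u v → col g u ≡ col g v
    equal u v with col g u ≟ col g v
    ... | yes eq = eq
    ... | no neq = contradiction (u , v , neq) const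

  -- A constant column is level, and if the ascended column is level, then the column it came from
  -- is constant by `descend`.
  ascend-nonConstant : ∀ {g} (P : Peak g) {h g₁ h₁} (t : AtTop P h) (e : E G g g₁) (f : E H h h₁)
    (new : col g₁ h₁ ≢ seq (end P h) 1) → NonConstant g → NonConstant g₁
  ascend-nonConstant P {g₁ = g₁} t e f new (u , v , neq) with nonConstant? g₁
  ... | yes nc = nc
  ... | no ¬nc = contradiction (allTop⇒constant (constant⇒allTop ascended ¬nc) u v) neq
    where open Ascend P t e f new

  -- The neighbours of a top vertex of an ascended column were at the top before the ascent, so
  -- a long climb is possible only from a column that is level, hence constant.
  climb : ∀ n {g} (P : Peak g) → NonConstant g → Found ⊎ ∃ λ h → ∀ h′ → Steps H n h h′ → AtTop P h′
  climb zero    P nc = inj₂ (apex P , λ { _ refl → apex-top P })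
  climb (suc n) P nc with ascending? P
  ... | inj₂ isolated = inj₁ (_ , P , nc , isolated)
  ... | inj₁ (h , (g₁ , h₁) , t , (e , f) , new) with climb n (Ascend.ascended P t e f new) (ascend-nonConstant P t e f new nc)
  ...   | inj₁ found = inj₁ found
  ...   | inj₂ (h₂ , all) = inj₂ (h₂ , λ { h′ (v , st , e′) → proj₁ (Ascend.descend P t e f new (all v st) (symm H e′)) })

  findIsolated : ∀ {g} → Column g → NonConstant g → Found
  findIsolated {g} C nc with ascending? (peak C)
  ... | inj₂ isolated = g , peak C , nc , isolated
  -- One ascent precedes the climb, since levelness of an ascended column yields constancy of the
  -- column before it.
  ... | inj₁ (h , (g₁ , h₁) , t , (e , f) , new)
    with climb (proj₁ (uniformSteps H walkH)) (Ascend.ascended (peak C) t e f new) (ascend-nonConstant (peak C) t e f new nc)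
  ...   | inj₁ found      = found
  ...   | inj₂ (h₂ , all) = contradiction
    (Ascend.allTop⇒constant (peak C) t e f new (λ h → all h (proj₂ (uniformSteps H walkH) h₂ h)) _ _) (proj₂ (proj₂ nc))

  Tuple : Set
  Tuple = (Vx G × Vx H) × (Vx H × Vx H)

  -- Colour changes across two steps of H; their number is the measure that each recolouring
  -- decreases.
  Variation : Tuple → Set
  Variation ((g , h₁) , (h , h₂)) = (E H h₁ h × E H h₂ h) × col g h₁ ≢ col g h₂

  variation? : ∀ t → Dec (Variation t)
  variation? ((g , h₁) , (h , h₂)) = (adj? H h₁ h ×-dec adj? H h₂ h) ×-dec ¬? (col g h₁ ≟ col g h₂)

listedTuples : (G H : Graph) → Listed ((Vx G × Vx H) × (Vx H × Vx H))
listedTuples G H = (listedVertices G ×-listed listedVertices H) ×-listed (listedVertices H ×-listed listedVertices H)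

-- Recolouring at isolated peaks

module Columns (G H K : Graph) (sf : SquareFree K) (walkG : ∀ u v → Wk (raw G) false u v)
  (walkH : ∀ u v → Wk (raw H) false u v) where

  private
    X = raw G ⊗ raw H
    module P (μ : Hom X (raw K)) = Peaks G H K sf walkH μ

  variations : Hom X (raw K) → ℕ
  variations μ = count (P.variation? μ) (Listed.elems (listedTuples G H))

  module Recolour (μ : Hom X (raw K)) where
    open P μ hiding (X)
    open Peak
    open Words K using (recast; recast-≈)

    -- The vertices sitting at a topmost point of the column all have neighbours of a single
    -- colour p, so they can take the colour of some vertex nearby in the column.
    module At {g} (Q : Peak g) (nc : NonConstant g) (isolated : Isolated Q) where
      v p : Vx K
      v = col g (apex Q)
      p = seq (end Q (apex Q)) 1

      In : Vx H → Set
      In h = AtTop Q h × col g h ≡ v × seq (end Q h) 1 ≡ p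

      in? : ∀ h → Dec (In h)
      in? h = (ht (end Q h) ℤₚ.≟ top Q) ×-dec ((col g h ≟ v) ×-dec (seq (end Q h) 1 ≟ p))

      in-closed : ∀ {h₁ h h₂} → E H h₁ h → E H h₂ h → In h₁ → col g h₁ ≡ col g h₂ → In h₂
      in-closed e₁ e₂ (t , eq , eq′) same = let s = same-end (column Q) e₁ e₂ same in
        trans (sym (≈-hts s)) t , trans (sym same) eq , trans (sym (pts s 1)) eq′

      -- A walk from the apex to a vertex of another colour stays in `In` as long as the colour
      -- after every two steps is `v`, by `in-closed`. Where it leaves, `h₂` supplies the new
      -- colour.
      Exit : Set
      Exit = ∃ λ h₁ → ∃ λ h → ∃ λ h₂ → In h₁ × E H h₁ h × E H h₂ h × col g h₂ ≢ v

      leave : ∀ {h u} → In h → Wk (raw H) false h u → col g u ≢ v → Exit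
      leave i nil neq = contradiction (proj₁ (proj₂ i)) neq
      leave i (step {y = h} a (step {y = h₂} b w)) neq with col g h₂ ≟ v
      ... | no neq′ = _ , h , h₂ , i , a , symm H b , neq′
      ... | yes eq  = leave (in-closed a (symm H b) i (trans (proj₁ (proj₂ i)) (sym eq))) w neq

      exit : Exit
      exit = let (u , ≢v) = other in leave {apex Q} {u} (apex-top Q , refl , refl) (walkH _ _) ≢v
        where
        other : ∃ λ u → col g u ≢ v
        other with col g (proj₁ nc) ≟ v
        ... | no neq = proj₁ nc , neq
        ... | yes eq = proj₁ (proj₂ nc) , λ eq′ → proj₂ (proj₂ nc) (trans eq (sym eq′))

      h₁ h₀ h₂ : Vx H
      h₁ = proj₁ exit
      h₀ = proj₁ (proj₂ exit)
      h₂ = proj₁ (proj₂ (proj₂ exit))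

      in-h₁ : In h₁
      in-h₁ = proj₁ (proj₂ (proj₂ (proj₂ exit)))

      e₁ : E H h₁ h₀
      e₁ = proj₁ (proj₂ (proj₂ (proj₂ (proj₂ exit))))

      e₂ : E H h₂ h₀
      e₂ = proj₁ (proj₂ (proj₂ (proj₂ (proj₂ (proj₂ exit)))))

      h₂≢v : col g h₂ ≢ v
      h₂≢v = proj₂ (proj₂ (proj₂ (proj₂ (proj₂ (proj₂ exit)))))

      q : Vx K
      q = col g h₂

      Moved : V X → Set
      Moved (g′ , h) = g′ ≡ g × In h

      moved? : ∀ x → Dec (Moved x)
      moved? (g′ , h) = vertex-≟ G g′ g ×-dec in? h

      moved-neighbour : ∀ {x y} → Moved x → Adj X x y → fun μ y ≡ p
      moved-neighbour (refl , t , _ , eq) (e , f) = trans (isolated t e f) eq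

      moved-independent : ∀ {x y} → Moved x → Adj X x y → ¬ Moved y
      moved-independent (refl , _) (e , _) (refl , _) = loopless G _ e

      q-p : E K q p
      -- A vertex over `h₀` in a neighbouring column has colour `p` because it is adjacent to the
      -- moved vertex at `h₁`; it is also adjacent to the vertex at `h₂`, of colour `q`.
      q-p = subst (E K q) (moved-neighbour {g , h₁} (refl , in-h₁) (nbG g , e₁)) (pres μ (nbG g , e₂))

      recolour : ∀ {P : Set} → Dec P → V X → Vx K
      recolour (yes _) x = q
      recolour (no  _) x = fun μ x

      recolour-adj : ∀ {x y} (d : Dec (Moved x)) (d′ : Dec (Moved y)) → Adj X x y → E K (recolour d x) (recolour d′ y)
      recolour-adj (yes m) (yes m′) e = contradiction m′ (moved-independent m e)
      recolour-adj (yes m) (no _)   e = subst (E K q) (sym (moved-neighbour m e)) q-p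
      recolour-adj (no _)  (yes m′) e = symm K (subst (E K q) (sym (moved-neighbour m′ (X-symm e))) q-p)
      recolour-adj (no _)  (no _)   e = pres μ e

      ν : Hom X (raw K)
      ν = hom (λ x → recolour (moved? x) x) (λ {x} {y} → recolour-adj (moved? x) (moved? y))

      ν-unmoved : ∀ {x} → ¬ Moved x → fun μ x ≡ fun ν x
      ν-unmoved {x} ¬m with moved? x
      ... | yes m = contradiction m ¬m
      ... | no _  = refl

      ν-moved : ∀ {x} → Moved x → fun ν x ≡ q
      ν-moved {x} m with moved? x
      ... | yes _ = refl
      ... | no ¬m = contradiction m ¬m

      agree : ∀ {x y} → Adj X x y → fun μ x ≡ fun ν x ⊎ fun μ y ≡ fun ν y
      agree {x} {y} e = by-cases (moved? x)
        where
        by-cases : Dec (Moved x) → fun μ x ≡ fun ν x ⊎ fun μ y ≡ fun ν y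
        by-cases (yes m) = inj₂ (ν-unmoved (moved-independent m e))
        by-cases (no ¬m) = inj₁ (ν-unmoved ¬m)

      reach : Reachable μ ν
      reach = Interpolate.reach (Productₚ.≡-dec (vertex-≟ G) (vertex-≟ H)) listedX (symm K) μ ν agree (g , h₁)

      g₁ : Vx G
      g₁ = proj₁ (noIsolated G g)

      C₁ : Column g₁
      C₁ = transport (nbG g) (column Q)

      unmoved₁ : ∀ h → fun μ (g₁ , h) ≡ fun ν (g₁ , h)
      unmoved₁ h = ν-unmoved λ (eq , _) → loopless G g (subst (E G g) eq (nbG g))

      -- Column `g` changes its colours, so the ends are kept in the neighbouring column `g₁`, which
      -- does not. Any two neighbours of a moved vertex have the same colour `p`, so by injectivity
      -- of pushing their ends already coincide before the push to the new colour.
      newColumn : P.Column ν g₁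
      newColumn = record { end = end′ ; coherent = λ e f₁ f₂ → coherent′ (moved? _) e f₁ f₂ }
        where
        end′ : ∀ h → End (fun ν (g₁ , h))
        end′ h = recast (unmoved₁ h) (Column.end C₁ h)
        end′-≈ : ∀ h → end′ h ≈[ 0ℤ ] Column.end C₁ h
        end′-≈ h = recast-≈ (unmoved₁ h) (Column.end C₁ h)
        coherent′ : ∀ {g₂ k₁ k k₂} → Dec (Moved (g₂ , k)) → (e : E G g₁ g₂) (f₁ : E H k₁ k) (f₂ : E H k₂ k) →
                    push (pres ν (e , f₁)) (end′ k₁) ≈[ 0ℤ ] push (pres ν (e , f₂)) (end′ k₂)
        coherent′ {k₁ = k₁} {k₂ = k₂} (yes m) e f₁ f₂ = push-cong refl (≈-trans (end′-≈ k₁) (≈-trans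
          (push-injective (trans (moved-neighbour m (X-symm (e , f₁))) (sym (moved-neighbour m (X-symm (e , f₂))))) refl
            (Column.coherent C₁ e f₁ f₂)) (≈-sym₀ (end′-≈ k₂))))
        coherent′ {k₁ = k₁} {k₂ = k₂} (no ¬m) e f₁ f₂ =
          ≈-trans (push-cong {e′ = pres μ (e , f₁)} (sym (ν-unmoved ¬m)) (end′-≈ k₁))
            (≈-trans (Column.coherent C₁ e f₁ f₂) (push-cong (ν-unmoved ¬m) (≈-sym₀ (end′-≈ k₂))))

      -- By `in-closed`, vertices of one colour that are two steps apart are moved together or not
      -- at all, so no variation is created.
      merge : ∀ {g′ k₁ k k₂} → E H k₁ k → E H k₂ k → fun μ (g′ , k₁) ≡ fun μ (g′ , k₂) → fun ν (g′ , k₁) ≡ fun ν (g′ , k₂)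
      merge {g′} {k₁} {k} {k₂} f₁ f₂ eq = by-cases (moved? (g′ , k₁)) (moved? (g′ , k₂))
        where
        by-cases : Dec (Moved (g′ , k₁)) → Dec (Moved (g′ , k₂)) → fun ν (g′ , k₁) ≡ fun ν (g′ , k₂)
        by-cases (yes m) (yes m′) = trans (ν-moved m) (sym (ν-moved m′))
        by-cases (no ¬m) (no ¬m′) = trans (sym (ν-unmoved ¬m)) (trans eq (ν-unmoved ¬m′))
        by-cases (yes (refl , i)) (no ¬m) = contradiction (refl , in-closed f₁ f₂ i eq) ¬m
        by-cases (no ¬m) (yes (refl , i)) = contradiction (refl , in-closed f₂ f₁ i (sym eq)) ¬m

      fewer : variations ν ℕ.< variations μ
      fewer = count-strict (P.variation? ν) variation? still (Listed.elems (listedTuples G H))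
        -- This variation disappears: afterwards both vertices have colour `q`.
        (Listed.complete (listedTuples G H) ((g , h₁) , (h₀ , h₂)))
        ((e₁ , e₂) , λ eq → h₂≢v (trans (sym eq) (proj₁ (proj₂ in-h₁))))
        λ (_ , neq) → neq (trans (ν-moved (refl , in-h₁)) (ν-unmoved λ (_ , i) → h₂≢v (proj₁ (proj₂ i))))
        where
        still : ∀ t → P.Variation ν t → Variation t
        still ((g′ , k₁) , (k , k₂)) ((f₁ , f₂) , neq) = (f₁ , f₂) , λ eq → neq (merge f₁ f₂ eq)

  settle : ∀ {g} (μ : Hom X (raw K)) → P.Column μ g →
           Σ (Hom X (raw K)) λ μ* → Reachable μ μ* × FactorsThrough μ* (raw G)
  settle μ C = go μ (<-wellFounded (variations μ)) C
    where
    go : ∀ {g} (μ : Hom X (raw K)) → Acc ℕ._<_ (variations μ) → P.Column μ g →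
         Σ (Hom X (raw K)) λ μ* → Reachable μ μ* × FactorsThrough μ* (raw G)
    go μ (acc rs) C with any-listed? (listedVertices G) (P.nonConstant? μ)
    ... | yes (g , nc) =
      let (_ , Q , nc′ , isolated) = P.findIsolated μ (P.carry μ (walkG _ g) C) nc
          open Recolour.At μ Q nc′ isolated
          (μ* , r , f) = go ν (rs fewer) newColumn
      in μ* , reachable-trans reach r , f
    ... | no const = μ , start , hom proj₁ proj₁ , hom (λ g → fun μ (g , someVertex H)) δ-pres , λ (g , h) → equal g h (someVertex H)
      where
      equal : ∀ g h h′ → fun μ (g , h) ≡ fun μ (g , h′)
      equal g h h′ with vertex-≟ K (fun μ (g , h)) (fun μ (g , h′))
      ... | yes eq = eq
      ... | no neq = contradiction (g , h , h′ , neq) const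
      δ-pres : ∀ {g g′} → E G g g′ → E K (fun μ (g , someVertex H)) (fun μ (g′ , someVertex H))
      δ-pres {g} {g′} e = let (h , f) = noIsolated H (someVertex H) in
        subst (E K _) (equal g′ h (someVertex H)) (pres μ (e , f))

-- Exchanging the factors

swapHom : ∀ {G H K} → Hom (G ⊗ H) K → Hom (H ⊗ G) K
swapHom μ = hom (λ (h , g) → fun μ (g , h)) (λ (f , e) → pres μ (e , f))

swapReachable : ∀ {G H K} {μ ν : Hom (G ⊗ H) K} → Reachable μ ν → Reachable (swapHom μ) (swapHom ν)
swapReachable start = start
swapReachable (next r ((g , h) , same)) = next (swapReachable r)
  ((h , g) , λ (h′ , g′) neq → same (g′ , h′) λ { refl → neq refl })

swapFactors : ∀ {G H K I} {μ : Hom (G ⊗ H) K} → FactorsThrough μ I → FactorsThrough (swapHom μ) I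
swapFactors (γ , δ , eq) = swapHom γ , δ , λ (h , g) → eq (g , h)

swapWalk : ∀ {G H b x y} → Wk (G ⊗ H) b x y → Wk (H ⊗ G) b (proj₂ x , proj₁ x) (proj₂ y , proj₁ y)
swapWalk nil              = nil
swapWalk (step (e , f) w) = step (f , e) (swapWalk w)

module _ (G H K : Graph) (μ : Hom (raw G ⊗ raw H) (raw K)) where
  open Ends K

  act-swapWalk : ∀ {b x y} (w : Wk (raw G ⊗ raw H) b x y) s →
                 Action.act (swapHom μ) (swapWalk w) s ≡ Action.act μ w s
  act-swapWalk nil        s = refl
  act-swapWalk (step e w) s = act-swapWalk w _

  act-liftH-swap : ∀ {g l h h′} (e : E G g l) (B : Wk (raw H) false h h′) s →
                   Action.act (swapHom μ) (Lifts.liftG H G e B) s ≡ Action.act μ (Lifts.liftH G H e B) s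
  act-liftH-swap e nil                 s = refl
  act-liftH-swap e (step a (step b B)) s = act-liftH-swap e B _

-- Finding the factor that translates

Settled : (G : Graph) {R S : RawGraph} → Hom R S → Set
Settled G {R} {S} μ = Σ (Hom R S) λ μ* → Reachable μ μ* × (FactorsThrough μ* (raw G) ⊎ ∃ λ n → FactorsThrough μ* (Cyc n))

module Settle (G H K : Graph) (sf : SquareFree K)
  (walkG : ∀ b u v → Wk (raw G) b u v) (walkH : ∀ b u v → Wk (raw H) b u v) where

  walkX : ∀ b x y → Wk (raw G ⊗ raw H) b x y
  walkX b (g , h) (g′ , h′) = Lifts.combine G H (walkG b g g′) (walkH b h h′)

  module _ (μ : Hom (raw G ⊗ raw H) (raw K)) where
    open Fields G H K sf μ
    module T = Tracking K {X} (Productₚ.≡-dec (vertex-≟ G) (vertex-≟ H)) listedX X-symm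
                 (someVertex G , someVertex H) (λ x → false , walkX false _ x)

    tracks : (W : Winding) → T.Tracks μ (Winding.bound W) (Winding.period W)
    tracks W = record { end = end ; trail = trail ; periodic = periodic }
      where
      open Winding W
      trail : ∀ {x y} → Adj X x y → T.TailOf (end x) (end y) ⊎ T.TailOf (end y) (end x)
      trail {x} e with pushX e (end x) | view (pres μ e) (end x) | coherent e
      ... | _ | back _ ps _  | q = inj₁ λ i → trans (sym (q i)) (ps i)
      ... | _ | forth _ ps _ | q = inj₂ λ i → trans (sym (ps i)) (q (suc i))

    settle : ∀ {g} → Column g ⊎ Winding → Settled G μ
    settle (inj₁ C) = let (μ* , r , f) = Columns.settle G H K sf (walkG false) (walkH false) μ C in μ* , r , inj₁ f
    settle (inj₂ W) = let (μ* , r , f) = T.settle (Winding.bound W) (Winding.positive W) (tracks W) in μ* , r , inj₂ f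

    settle-translated : ∀ g h (s : End (fun μ (g , h))) (σ : Wk X true (g , h) (g , h)) {c} → act σ s ≈[ c ] s →
                        (A : Wk (raw G) false g g) {a : ℤ} → a ≢ 0ℤ → act (liftG (nbH h) A) s ≈[ a ] s → Settled G μ
    settle-translated g h s σ σ-fix A a≢0 A-fix =
      settle (Classify.classify (walkH false) walkX g h s σ σ-fix A a≢0 A-fix)

module OddClosed (G H K : Graph) (sf : SquareFree K)
  (walkG : ∀ b u v → Wk (raw G) b u v) (walkH : ∀ b u v → Wk (raw H) b u v)
  (μ : Hom (raw G ⊗ raw H) (raw K)) {g : Vx G} {h : Vx H} (σ : Wk (raw G ⊗ raw H) true (g , h) (g , h)) where
  open Fields G H K sf μ
  open Settle using (settle-translated)

  A : Wk (raw G) false g g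
  A = projG (σ ++ σ)

  B : Wk (raw H) false h h
  B = projH (σ ++ σ)

  actA actB : End (fun μ (g , h)) → End (fun μ (g , h))
  actA = act (liftG (nbH h) A)
  actB = act (liftH (nbG g) B)

  σσ-split : ∀ t → act (σ ++ σ) t ≈[ 0ℤ ] actB (actA t)
  σσ-split = split (σ ++ σ) (nbH h) (nbG g)

  module _ {c : ℤ} (c≢0 : c ≢ 0ℤ) {s : End (fun μ (g , h))} (fix : act σ s ≈[ c ] s) where

    σσ-fix : act (σ ++ σ) s ≈[ c ℤ.+ c ] s
    σσ-fix = ≈-transˡ (act-++ σ σ s) (≈-trans (act-cong σ fix) fix)

    -- The square of `σ` acts as `A` followed by `B`, and these commute, so it translates the image
    -- of `s` under `A` by the same amount as `s`. By `fixed-unique` that image is `s` up to height.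
    A-commutes : act (σ ++ σ) (actA s) ≈[ c ℤ.+ c ] actA s
    A-commutes = ≈-transˡ (≈-trans (σσ-split (actA s)) (commute A B (nbH h) (nbH h) (nbG g) (nbG g) (actA s)))
      (act-cong (liftG (nbH h) A) (≈-transˡ (≈-sym₀ (σσ-split s)) σσ-fix))

    a b : ℤ
    a = ht (actA s) ℤ.- ht s
    b = ℤ.- a ℤ.+ (c ℤ.+ c)

    A-fix : actA s ≈[ a ] s
    A-fix = pts⇒≈ λ i → sym (fixed-unique (σ ++ σ) s (actA s) (λ eq → c≢0 (double-zero c eq)) σσ-fix A-commutes i)

    B-fix : actB s ≈[ b ] s
    B-fix = ≈-trans (≈-sym (act-cong (liftH (nbG g) B) A-fix)) (≈-transˡ (≈-sym₀ (σσ-split s)) σσ-fix)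

    b≢0 : a ≡ 0ℤ → b ≢ 0ℤ
    b≢0 a≡0 b≡0 = c≢0 (double-zero c (trans (sym (ℤₚ.+-identityˡ _))
      (trans (cong (λ z → ℤ.- z ℤ.+ (c ℤ.+ c)) (sym a≡0)) b≡0)))

    -- σ² moves s by 2c ≠ 0, so one of its components in G and in H moves s.
    settled : Settled G μ ⊎ Settled H (swapHom μ)
    settled with a ℤₚ.≟ 0ℤ
    ... | no a≢0  = inj₁ (settle-translated G H K sf walkG walkH μ g h s σ fix A a≢0 A-fix)
    ... | yes a≡0 = inj₂ (settle-translated H G K sf walkH walkG (swapHom μ) h g s (swapWalk σ) {c}
      (subst (_≈[ c ] s) (sym (act-swapWalk G H K μ σ s)) fix) B {b} (b≢0 a≡0)
      (subst (_≈[ b ] s) (sym (act-liftH-swap G H K μ (nbG g) B s)) B-fix))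

theorem20 : (G H K : Graph) → SquareFree K → Connected G → Connected H →
    ¬ Bipartite G → ¬ Bipartite H → (μ : Hom (raw G ⊗ raw H) (raw K)) →
    Σ (Hom (raw G ⊗ raw H) (raw K)) λ μ* → Reachable μ μ* ×
    (FactorsThrough μ* (raw G) ⊎ FactorsThrough μ* (raw H) ⊎ Σ ℕ λ n → FactorsThrough μ* (Cyc n))
theorem20 G H K sf connG connH ¬bipG ¬bipH μ = conclude
  (let (_ , _ , c≢0 , fix) = Words.oddFixed K μ σ in OddClosed.settled G H K sf walkG walkH μ σ c≢0 fix)
  where
  walkG : ∀ b u v → Wk (raw G) b u v
  walkG = parityWalk G connG ¬bipG

  walkH : ∀ b u v → Wk (raw H) b u v
  walkH = parityWalk H connH ¬bipH

  σ : Wk (raw G ⊗ raw H) true (someVertex G , someVertex H) (someVertex G , someVertex H)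
  σ = Settle.walkX G H K sf walkG walkH true _ _

  conclude : Settled G μ ⊎ Settled H (swapHom μ) → _
  conclude (inj₁ (μ* , r , inj₁ f))       = μ* , r , inj₁ f
  conclude (inj₁ (μ* , r , inj₂ f))       = μ* , r , inj₂ (inj₂ f)
  conclude (inj₂ (μ* , r , inj₁ f))       = swapHom μ* , swapReachable r , inj₂ (inj₁ (swapFactors {μ = μ*} f))
  conclude (inj₂ (μ* , r , inj₂ (n , f))) = swapHom μ* , swapReachable r , inj₂ (inj₂ (n , swapFactors {μ = μ*} f))
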